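{- There is an absolute constant $C>0$ such that the following holds. Let $w$ be a positive integer, let $s$ be the largest integer with $1 - (1-2^{ -w})^s \le 1/2$, and let $n = sw$. Let $A = \{x \in \{0,1\}^n : \mathrm{Tribes}_{w,s}(x) = 1\}$ and let $A^* \subseteq \{0,1\}^n$ be any superset of $A$ with $|A^*| = 2^{n-1}$. Identify $\{0,1\}^{n-1}$ with $\{x \in \{0,1\}^n : x_n = 0\}$. Then there exists a bijection $\phi \colon \{0,1\}^{n-1} \to A^*$ such that $\mathbb{E}_{x \in \{0,1\}^{n-1}}[\mathrm{dist}(x,\phi(x))] \le C\log n$ (with $x$ uniform in $\{0,1\}^{n-1}$), and in particular $\mathrm{avgstretch}(\phi) \le 2C\log n + 1$.
   Context: $\mathrm{Tribes}_{w,s} \colon \{0,1\}^{sw} \to \{0,1\}$ is $\bigvee_{i=1}^s (x_{(i-1)w+1} \wedge \dots \wedge x_{iw})$, i.e. the inputs are partitioned into $s$ consecutive blocks of size $w$ and the value is 1 iff some block is all ones. $\mathrm{dist}$ is the Hamming distance, and for a bijection $\phi \colon \{0,1\}^{n-1} \to A^*$, $\mathrm{avgstretch}(\phi) = \mathbb{E}[\mathrm{dist}(\phi(x),\phi(x'))]$ over a uniformly random pair $x,x' \in \{0,1\}^{n-1}$ differing in exactly one coordinate.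
   Formalization: The statement is proved for w ≥ 2; for w = 1 it fails, since then s = n = 1 and log n = 0, while the only bijection from {(0)} to A* = {(1)} moves its point by distance 1. -}

module Defs where

open import Data.Bool using (Bool; true; false; _∧_; _∨_; not; if_then_else_)
open import Data.Nat using (ℕ; zero; suc; _+_; _*_; _^_; _≤_)
open import Data.Vec using (Vec; []; _∷_; take; drop; _∷ʳ_; _[_]%=_)
open import Data.List using (List; map; _++_; allFin) renaming ([] to []ˡ; _∷_ to _∷ˡ_)
open import Data.Nat.ListAction using (sum)
open import Data.Fin using (Fin)
open import Data.Product using (Σ; proj₁)
open import Relation.Binary.PropositionalEquality using (_≡_)

allOnes : ∀ {n} → Vec Bool n → Bool
allOnes []       = true
allOnes (b ∷ bs) = b ∧ allOnes bs

tribes : (w s : ℕ) → Vec Bool (s * w) → Bool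
tribes w zero    xs = false
tribes w (suc s) xs = allOnes (take w xs) ∨ tribes w s (drop w xs)

-- The defining condition for s:  1 - (1 - 2^{-w})^s ≤ 1/2,
-- i.e. (1 - 2^{-w})^s ≥ 1/2, i.e. 2^{w s} ≤ 2 (2^w - 1)^s  (cleared denominators).
TribesCond : (w s : ℕ) → Set
TribesCond w s = 2 ^ (w * s) ≤ 2 * (2 ^ w Data.Nat.∸ 1) ^ s

IsLargestS : (w s : ℕ) → Set
IsLargestS w s = TribesCond w s Data.Product.× (∀ t → TribesCond w t → t ≤ s)

dist : ∀ {n} → Vec Bool n → Vec Bool n → ℕ
dist []       []       = 0
dist (a ∷ as) (b ∷ bs) = (if a Data.Bool.xor b then 1 else 0) + dist as bs

allVecs : (n : ℕ) → List (Vec Bool n)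
allVecs zero    = [] ∷ˡ []ˡ
allVecs (suc n) = map (false ∷_) (allVecs n) ++ map (true ∷_) (allVecs n)

count : ∀ {n} → (Vec Bool n → Bool) → ℕ
count {n} P = sum (map (λ x → if P x then 1 else 0) (allVecs n))

-- the identification of {0,1}^{n-1} (here n = suc m) with {x ∈ {0,1}^n : x_n = 0}
embed : ∀ {m} → Vec Bool m → Vec Bool (suc m)
embed x = x ∷ʳ false

flipAt : ∀ {m} → Vec Bool m → Fin m → Vec Bool m
flipAt x i = x [ i ]%= not

-- Σ_x dist(embed x, φ x)   (= 2^m · E_x[dist(x, φ(x))])
totalDisplacement : ∀ {m} {P : Vec Bool (suc m) → Bool} →
  (Vec Bool m → Σ (Vec Bool (suc m)) (λ y → P y ≡ true)) → ℕ
totalDisplacement {m} φ = sum (map (λ x → dist (embed x) (proj₁ (φ x))) (allVecs m))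

-- Σ over ordered pairs (x, x ⊕ e_i) of dist(φ x, φ x')   (= m · 2^m · avgstretch φ)
totalStretch : ∀ {m} {P : Vec Bool (suc m) → Bool} →
  (Vec Bool m → Σ (Vec Bool (suc m)) (λ y → P y ≡ true)) → ℕ
totalStretch {m} φ =
  sum (map (λ x → sum (map (λ i → dist (proj₁ (φ x)) (proj₁ (φ (flipAt x i)))) (allFin m)))
           (allVecs m))

{-# OPTIONS --safe #-}

-- Put K = 2 ^ w, let A be the ones and N the zeros of Tribes, and view a point
-- as s blocks over an alphabet of size K with a distinguished letter ★ = 1…1.
-- Send y ∈ A uniformly to the points of N obtained by replacing each ★ of y by
-- another letter.  By symmetry every point of N receives mass |A| / |N| ≤ 1, and
-- y travels at most w · (number of ★ in y), which sums to w s K^(s-1) ≤ w K^s.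
-- Averaging this with the identity on A spreads A over the whole cube with
-- density at most 1/2, and dropping the last bit turns that into a fractional
-- matching of A into the half-cube.  Hall's theorem makes it integral at no cost,
-- because the bound on the distance depends on y only.  By maximality of s the
-- set A* ∖ A has at most 2^(n-1) / (K-1) points; each is matched arbitrarily, at
-- distance at most n ≤ (K-1) w.
module Submission where

open import Defs
open import Axiom.UniquenessOfIdentityProofs.WithK using (uip)
open import Data.Bool using (Bool; true; false; _∧_; _∨_; not; if_then_else_; _xor_)
open import Data.Bool.Properties using (∨-zeroʳ; ∧-zeroʳ; T-≡)
open import Data.Empty using (⊥-elim)
open import Data.Fin using (Fin; zero; suc)
open import Data.List using (List; map; _++_; length; allFin) renaming ([] to []ˡ; _∷_ to _∷ˡ_)
open import Data.List.Membership.Propositional using (_∈_)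
open import Data.List.Membership.Propositional.Properties using (∈-++⁺ˡ; ∈-++⁺ʳ; ∈-map⁺)
open import Data.List.Properties using (map-++; map-∘; length-tabulate)
open import Data.List.Relation.Unary.Any using (here; there)
open import Data.Nat using (ℕ; zero; suc; _*_; _+_; _∸_; _^_; _≤_; _<_; z≤n; s≤s; _≤?_; _≤ᵇ_; NonZero; >-nonZero)
open import Data.Nat.ListAction using (sum)
open import Data.Nat.ListAction.Properties using (sum-++)
open import Data.Nat.Logarithm using (⌊log₂_⌋; ⌊log₂⌋-mono-≤; ⌊log₂[2^n]⌋≡n)
open import Data.Nat.Properties
open import Data.Nat.Tactic.RingSolver using (solve-∀)
open import Data.Product using (Σ; ∃; _×_; _,_; proj₁; proj₂)
open import Data.Sum using (_⊎_; inj₁; inj₂)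
open import Data.Vec using (Vec; []; _∷_; _∷ʳ_; take; drop; head; tail; cast)
open import Data.Vec.Properties using (cast-is-id)
open import Function using (_∘_; id)
open import Function.Bundles using (Bijection; Equivalence)
open import Relation.Binary.PropositionalEquality using (_≡_; refl; sym; trans; cong; cong₂; subst; setoid; module ≡-Reasoning)
open import Relation.Nullary using (¬_; Dec; yes; no; contradiction)

-- Sums over the cube

-- Recursion on the dimension turns the laws below into inductions over the two half-cubes;
-- `∑-allVecs` relates this sum to the list sums of the statement.
∑ : ∀ {n} → (Vec Bool n → ℕ) → ℕ
∑ {zero}  f = f []
∑ {suc n} f = ∑ (λ x → f (false ∷ x)) + ∑ (λ x → f (true ∷ x))

∑-allVecs : ∀ {n} (f : Vec Bool n → ℕ) → sum (map f (allVecs n)) ≡ ∑ f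
∑-allVecs {zero}  f = +-identityʳ (f [])
∑-allVecs {suc n} f = begin
  sum (map f (map (false ∷_) V ++ map (true ∷_) V))
    ≡⟨ cong sum (map-++ f (map (false ∷_) V) (map (true ∷_) V)) ⟩
  sum (map f (map (false ∷_) V) ++ map f (map (true ∷_) V))
    ≡⟨ sum-++ (map f (map (false ∷_) V)) (map f (map (true ∷_) V)) ⟩
  sum (map f (map (false ∷_) V)) + sum (map f (map (true ∷_) V))
    ≡⟨ cong₂ _+_ (half false) (half true) ⟩
  ∑ f ∎
  where
  open ≡-Reasoning
  V : List (Vec Bool n)
  V = allVecs n
  half : ∀ b → sum (map f (map (b ∷_) V)) ≡ ∑ (λ x → f (b ∷ x))
  half b = trans (cong sum (sym (map-∘ V))) (∑-allVecs (λ x → f (b ∷ x)))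

∑-cong : ∀ {n} {f g : Vec Bool n → ℕ} → (∀ x → f x ≡ g x) → ∑ f ≡ ∑ g
∑-cong {zero}  h = h []
∑-cong {suc n} h = cong₂ _+_ (∑-cong (h ∘ (false ∷_))) (∑-cong (h ∘ (true ∷_)))

∑-mono : ∀ {n} {f g : Vec Bool n → ℕ} → (∀ x → f x ≤ g x) → ∑ f ≤ ∑ g
∑-mono {zero}  h = h []
∑-mono {suc n} h = +-mono-≤ (∑-mono (h ∘ (false ∷_))) (∑-mono (h ∘ (true ∷_)))

+-interchange : ∀ a b c d → (a + b) + (c + d) ≡ (a + c) + (b + d)
+-interchange = solve-∀

∑-+ : ∀ {n} (f g : Vec Bool n → ℕ) → ∑ (λ x → f x + g x) ≡ ∑ f + ∑ g
∑-+ {zero}  f g = refl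
∑-+ {suc n} f g = trans
  (cong₂ _+_ (∑-+ (f ∘ (false ∷_)) (g ∘ (false ∷_))) (∑-+ (f ∘ (true ∷_)) (g ∘ (true ∷_))))
  (+-interchange (∑ (f ∘ (false ∷_))) _ (∑ (f ∘ (true ∷_))) _)

∑-*ˡ : ∀ {n} c (f : Vec Bool n → ℕ) → ∑ (λ x → c * f x) ≡ c * ∑ f
∑-*ˡ {zero}  c f = refl
∑-*ˡ {suc n} c f = trans
  (cong₂ _+_ (∑-*ˡ c (f ∘ (false ∷_))) (∑-*ˡ c (f ∘ (true ∷_))))
  (sym (*-distribˡ-+ c _ _))

∑-*ʳ : ∀ {n} (f : Vec Bool n → ℕ) c → ∑ (λ x → f x * c) ≡ ∑ f * c
∑-*ʳ f c = trans (∑-cong (λ x → *-comm (f x) c)) (trans (∑-*ˡ c f) (*-comm c (∑ f)))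

∑-const : ∀ n c → ∑ {n} (λ _ → c) ≡ 2 ^ n * c
∑-const zero    c = sym (+-identityʳ c)
∑-const (suc n) c = trans (cong₂ _+_ (∑-const n c) (∑-const n c)) (double (2 ^ n) c)
  where
  double : ∀ a c → a * c + a * c ≡ 2 * a * c
  double = solve-∀

∑-0 : ∀ n → ∑ {n} (λ _ → 0) ≡ 0
∑-0 n = trans (∑-const n 0) (*-zeroʳ (2 ^ n))

∑-1 : ∀ n → ∑ {n} (λ _ → 1) ≡ 2 ^ n
∑-1 n = trans (∑-const n 1) (*-identityʳ (2 ^ n))

∑-swap : ∀ {n k} (f : Vec Bool n → Vec Bool k → ℕ) →
  ∑ (λ x → ∑ (f x)) ≡ ∑ (λ y → ∑ (λ x → f x y))
∑-swap {zero}  f = refl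
∑-swap {suc n} f = trans
  (cong₂ _+_ (∑-swap (f ∘ (false ∷_))) (∑-swap (f ∘ (true ∷_))))
  (sym (∑-+ (λ y → ∑ (λ x → f (false ∷ x) y)) (λ y → ∑ (λ x → f (true ∷ x) y))))

∑-∷ʳ : ∀ {n} (f : Vec Bool (suc n) → ℕ) → ∑ (λ x → f (x ∷ʳ false) + f (x ∷ʳ true)) ≡ ∑ f
∑-∷ʳ {zero}  f = refl
∑-∷ʳ {suc n} f = cong₂ _+_ (∑-∷ʳ (f ∘ (false ∷_))) (∑-∷ʳ (f ∘ (true ∷_)))

∑-split : ∀ w {n} (f : Vec Bool w → Vec Bool n → ℕ) →
  ∑ (λ x → f (take w x) (drop w x)) ≡ ∑ (λ a → ∑ (f a))
∑-split zero    f = refl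
∑-split (suc w) f = cong₂ _+_ (∑-split w (f ∘ (false ∷_))) (∑-split w (f ∘ (true ∷_)))

∑-split-* : ∀ w {n} (f : Vec Bool w → ℕ) (g : Vec Bool n → ℕ) →
  ∑ (λ x → f (take w x) * g (drop w x)) ≡ ∑ f * ∑ g
∑-split-* w f g = trans (∑-split w (λ a b → f a * g b))
  (trans (∑-cong (λ a → ∑-*ˡ (f a) g)) (∑-*ʳ f (∑ g)))

-- Boolean predicates on the cube

𝟙 : Bool → ℕ
𝟙 b = if b then 1 else 0

infix 4 _⊑_
_⊑_ : ∀ {n} → (Vec Bool n → Bool) → (Vec Bool n → Bool) → Set
Q ⊑ R = ∀ x → Q x ≡ true → R x ≡ true

𝟙-mono : ∀ {a b} → (a ≡ true → b ≡ true) → 𝟙 a ≤ 𝟙 b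
𝟙-mono {false}         h = z≤n
𝟙-mono {true}  {true}  h = ≤-refl
𝟙-mono {true}  {false} h with () ← h refl

𝟙≤1 : ∀ b → 𝟙 b ≤ 1
𝟙≤1 false = z≤n
𝟙≤1 true  = ≤-refl

∧-true : ∀ {a b} → a ∧ b ≡ true → a ≡ true × b ≡ true
∧-true {true} {true} refl = refl , refl

∨-true : ∀ {a b} → a ∨ b ≡ true → a ≡ true ⊎ b ≡ true
∨-true {true}          h = inj₁ refl
∨-true {false} {true}  h = inj₂ refl

∧-intro : ∀ {a b} → a ≡ true → b ≡ true → a ∧ b ≡ true
∧-intro refl refl = refl

∨-introˡ : ∀ {a b} → a ≡ true → a ∨ b ≡ true
∨-introˡ refl = refl

∨-introʳ : ∀ {a b} → b ≡ true → a ∨ b ≡ true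
∨-introʳ {a} refl = ∨-zeroʳ a

eqᵇ : ∀ {n} → Vec Bool n → Vec Bool n → Bool
eqᵇ []       []       = true
eqᵇ (a ∷ x) (b ∷ y) = not (a xor b) ∧ eqᵇ x y

eqᵇ-refl : ∀ {n} (x : Vec Bool n) → eqᵇ x x ≡ true
eqᵇ-refl []          = refl
eqᵇ-refl (false ∷ x) = eqᵇ-refl x
eqᵇ-refl (true ∷ x)  = eqᵇ-refl x

eqᵇ-sound : ∀ {n} {x y : Vec Bool n} → eqᵇ x y ≡ true → x ≡ y
eqᵇ-sound {x = []}        {[]}        h = refl
eqᵇ-sound {x = false ∷ x} {false ∷ y} h = cong (false ∷_) (eqᵇ-sound h)
eqᵇ-sound {x = true ∷ x}  {true ∷ y}  h = cong (true ∷_) (eqᵇ-sound h)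

∑-eqᵇ : ∀ {n} (y : Vec Bool n) (f : Vec Bool n → ℕ) → ∑ (λ x → 𝟙 (eqᵇ y x) * f x) ≡ f y
∑-eqᵇ []          f = +-identityʳ (f [])
∑-eqᵇ {suc n} (false ∷ y) f = trans
  (cong₂ _+_ (∑-eqᵇ y (f ∘ (false ∷_))) (∑-0 n))
  (+-identityʳ _)
∑-eqᵇ {suc n} (true ∷ y)  f =
  cong₂ _+_ (∑-0 n) (∑-eqᵇ y (f ∘ (true ∷_)))

∑-𝟙-eqᵇ : ∀ {n} (y : Vec Bool n) → ∑ (λ x → 𝟙 (eqᵇ y x)) ≡ 1
∑-𝟙-eqᵇ y = trans (∑-cong (λ x → sym (*-identityʳ (𝟙 (eqᵇ y x))))) (∑-eqᵇ y (λ _ → 1))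

any : ∀ {n} → (Vec Bool n → Bool) → Bool
any {zero}  Q = Q []
any {suc n} Q = any (Q ∘ (false ∷_)) ∨ any (Q ∘ (true ∷_))

any-intro : ∀ {n} (Q : Vec Bool n → Bool) x → Q x ≡ true → any Q ≡ true
any-intro Q []          h = h
any-intro Q (false ∷ x) h = ∨-introˡ (any-intro (Q ∘ (false ∷_)) x h)
any-intro Q (true ∷ x)  h = ∨-introʳ {any (Q ∘ (false ∷_))} (any-intro (Q ∘ (true ∷_)) x h)

any-elim : ∀ {n} (Q : Vec Bool n → Bool) → any Q ≡ true → ∃ λ x → Q x ≡ true
any-elim {zero}  Q h = [] , h
any-elim {suc n} Q h with ∨-true {any (Q ∘ (false ∷_))} h
... | inj₁ p = let x , q = any-elim (Q ∘ (false ∷_)) p in false ∷ x , q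
... | inj₂ p = let x , q = any-elim (Q ∘ (true ∷_)) p in true ∷ x , q

-- If `Q` missed `x`, adding the indicator of `x` would give a function bounded by 1 whose sum
-- exceeds `2 ^ n`.
∑-𝟙-full : ∀ {n} (Q : Vec Bool n → Bool) → 2 ^ n ≤ ∑ (𝟙 ∘ Q) → ∀ x → Q x ≡ true
∑-𝟙-full {n} Q full x with Q x in Qx
... | true  = refl
... | false = contradiction bound (<⇒≱ (s≤s full))
  where
  pointwise : ∀ y → 𝟙 (Q y) + 𝟙 (eqᵇ x y) ≤ 1
  pointwise y with eqᵇ x y in e
  ... | false = ≤-trans (≤-reflexive (+-identityʳ (𝟙 (Q y)))) (𝟙≤1 (Q y))
  ... | true  rewrite sym (eqᵇ-sound {x = x} {y} e) | Qx = ≤-refl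
  bound : suc (∑ (𝟙 ∘ Q)) ≤ 2 ^ n
  bound = begin
    suc (∑ (𝟙 ∘ Q))                      ≡⟨ +-comm 1 _ ⟩
    ∑ (𝟙 ∘ Q) + 1                        ≡⟨ cong (∑ (𝟙 ∘ Q) +_) (sym (∑-𝟙-eqᵇ x)) ⟩
    ∑ (𝟙 ∘ Q) + ∑ (λ y → 𝟙 (eqᵇ x y))    ≡⟨ sym (∑-+ (𝟙 ∘ Q) (λ y → 𝟙 (eqᵇ x y))) ⟩
    ∑ (λ y → 𝟙 (Q y) + 𝟙 (eqᵇ x y))      ≤⟨ ∑-mono pointwise ⟩
    ∑ {n} (λ _ → 1)                      ≡⟨ ∑-1 n ⟩
    2 ^ n                                ∎
    where open ≤-Reasoning

∑-𝟙-nonempty : ∀ {n} (Q : Vec Bool n → Bool) → 1 ≤ ∑ (𝟙 ∘ Q) → ∃ λ x → Q x ≡ true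
∑-𝟙-nonempty {n} Q h with any Q in e
... | true  = any-elim Q e
... | false = contradiction h (<⇒≱ (s≤s (≤-trans (∑-mono {n} none) (≤-reflexive (∑-0 n)))))
  where
  none : ∀ x → 𝟙 (Q x) ≤ 0
  none x with Q x in Qx
  ... | false = z≤n
  ... | true  with () ← trans (sym e) (any-intro Q x Qx)

∈-allVecs : ∀ {n} (x : Vec Bool n) → x ∈ allVecs n
∈-allVecs []          = here refl
∈-allVecs (false ∷ x) = ∈-++⁺ˡ (∈-map⁺ (false ∷_) (∈-allVecs x))
∈-allVecs (true ∷ x)  = ∈-++⁺ʳ (map (false ∷_) (allVecs _)) (∈-map⁺ (true ∷_) (∈-allVecs x))

-- Exhaustive search over predicates on the cube

glue : ∀ {n} → (Vec Bool n → Bool) → (Vec Bool n → Bool) → Vec Bool (suc n) → Bool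
glue Z₀ Z₁ (false ∷ x) = Z₀ x
glue Z₀ Z₁ (true ∷ x)  = Z₁ x

-- Stands in for function extensionality: `glue` rebuilds a predicate from its halves only up to
-- pointwise equality.
Extensional : ∀ {n} → ((Vec Bool n → Bool) → Set) → Set
Extensional F = ∀ {Z Z′} → (∀ x → Z x ≡ Z′ x) → F Z → F Z′

-- Search by induction on the dimension, splitting `Z` into its two halves: for a fixed first half
-- the second is settled by induction, which makes the claim about the first half decidable. This
-- produces the violators of Hall's condition needed below.
all-or-counterexample : ∀ {n} (F : (Vec Bool n → Bool) → Set) → Extensional F →
  (∀ Z → Dec (F Z)) → (∀ Z → F Z) ⊎ ∃ λ Z → ¬ F Z
all-or-counterexample {zero} F ext F? with F? (λ _ → false) | F? (λ _ → true)
... | no ¬p | _     = inj₂ (_ , ¬p)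
... | yes p | no ¬q = inj₂ (_ , ¬q)
... | yes p | yes q = inj₁ all
  where
  all : ∀ Z → F Z
  all Z with Z [] in e
  ... | false = ext (λ { [] → sym e }) p
  ... | true  = ext (λ { [] → sym e }) q
all-or-counterexample {suc n} F ext F? =
  finish (all-or-counterexample G G-ext G?)
  where
  G : (Vec Bool n → Bool) → Set
  G Z₀ = ∀ Z₁ → F (glue Z₀ Z₁)
  glue-congʳ : ∀ Z₀ → Extensional (λ Z₁ → F (glue Z₀ Z₁))
  glue-congʳ Z₀ e = ext (λ { (false ∷ x) → refl ; (true ∷ x) → e x })
  inner : ∀ Z₀ → G Z₀ ⊎ ∃ λ Z₁ → ¬ F (glue Z₀ Z₁)
  inner Z₀ = all-or-counterexample (λ Z₁ → F (glue Z₀ Z₁)) (glue-congʳ Z₀) (λ Z₁ → F? (glue Z₀ Z₁))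
  G-ext : Extensional G
  G-ext e g Z₁ = ext (λ { (false ∷ x) → e x ; (true ∷ x) → refl }) (g Z₁)
  G? : ∀ Z₀ → Dec (G Z₀)
  G? Z₀ with inner Z₀
  ... | inj₁ g        = yes g
  ... | inj₂ (Z₁ , c) = no (λ g → c (g Z₁))
  finish : (∀ Z₀ → G Z₀) ⊎ (∃ λ Z₀ → ¬ G Z₀) → (∀ Z → F Z) ⊎ ∃ λ Z → ¬ F Z
  finish (inj₁ g) = inj₁ (λ Z → ext (λ { (false ∷ x) → refl ; (true ∷ x) → refl })
                                    (g (Z ∘ (false ∷_)) (Z ∘ (true ∷_))))
  finish (inj₂ (Z₀ , c)) with inner Z₀
  ... | inj₁ g        = contradiction g c
  ... | inj₂ (Z₁ , d) = inj₂ (glue Z₀ Z₁ , d)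

-- Hall's theorem

-- Bisection: primality passes `F` to one half of the cube, and the family induced on that half is
-- again monotone and prime. After `m` bisections a single point is left.
prime⇒singleton : ∀ {m} (F : (Vec Bool m → Bool) → Set) →
  (∀ {Q R} → Q ⊑ R → F Q → F R) →
  (∀ {Q R} → F (λ x → Q x ∨ R x) → F Q ⊎ F R) →
  F (λ _ → true) → ∃ λ x → F (eqᵇ x)
prime⇒singleton {zero}  F mono prime f = [] , mono (λ { [] _ → refl }) f
prime⇒singleton {suc m} F mono prime f with prime {head} {not ∘ head}
  (mono (λ { (false ∷ x) _ → refl ; (true ∷ x) _ → refl }) f)
... | inj₁ p = let x , q = prime⇒singleton F₁ mono₁ (λ {Q} {R} → prime₁ {Q} {R}) (mono (λ x h → ∧-intro h refl) p)
               in true ∷ x , mono (λ { (true ∷ z) h → h ; (false ∷ z) () }) q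
  where
  F₁ : (Vec Bool m → Bool) → Set
  F₁ Q = F (λ x → head x ∧ Q (tail x))
  mono₁ : ∀ {Q R} → Q ⊑ R → F₁ Q → F₁ R
  mono₁ h = mono (λ { (true ∷ x) → h x ; (false ∷ x) () })
  prime₁ : ∀ {Q R} → F₁ (λ x → Q x ∨ R x) → F₁ Q ⊎ F₁ R
  prime₁ {Q} {R} g = prime {λ x → head x ∧ Q (tail x)} {λ x → head x ∧ R (tail x)}
    (mono (λ { (true ∷ x) h → h ; (false ∷ x) () }) g)
... | inj₂ p = let x , q = prime⇒singleton F₀ mono₀ (λ {Q} {R} → prime₀ {Q} {R}) (mono (λ x h → ∧-intro h refl) p)
               in false ∷ x , mono (λ { (false ∷ z) h → h ; (true ∷ z) () }) q
  where
  F₀ : (Vec Bool m → Bool) → Set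
  F₀ Q = F (λ x → not (head x) ∧ Q (tail x))
  mono₀ : ∀ {Q R} → Q ⊑ R → F₀ Q → F₀ R
  mono₀ h = mono (λ { (false ∷ x) → h x ; (true ∷ x) () })
  prime₀ : ∀ {Q R} → F₀ (λ x → Q x ∨ R x) → F₀ Q ⊎ F₀ R
  prime₀ {Q} {R} g = prime {λ x → not (head x) ∧ Q (tail x)} {λ x → not (head x) ∧ R (tail x)}
    (mono (λ { (false ∷ x) h → h ; (true ∷ x) () }) g)

Graph : ℕ → ℕ → Set
Graph n m = Vec Bool n → Vec Bool m → Bool

nbhd : ∀ {n m} → Graph n m → (Vec Bool n → Bool) → Vec Bool m → Bool
nbhd E Z x = any (λ y → Z y ∧ E y x)

module Marriage {n m : ℕ} (P : Vec Bool n → Bool) where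

  -- Only the points of `P` have to be matched; counting them inside `Z` keeps every set a predicate
  -- on the whole cube.
  demand : (Vec Bool n → Bool) → ℕ
  demand Z = ∑ (λ y → 𝟙 (Z y ∧ P y))

  HallAt : Graph n m → (Vec Bool n → Bool) → Set
  HallAt E Z = demand Z ≤ ∑ (𝟙 ∘ nbhd E Z)

  Hall : Graph n m → Set
  Hall E = ∀ Z → HallAt E Z

  nbhd-mono : ∀ {E E′ : Graph n m} Z Z′ → (∀ y x → Z y ≡ true → E y x ≡ true → Z′ y ≡ true × E′ y x ≡ true) →
    nbhd E Z ⊑ nbhd E′ Z′
  nbhd-mono Z Z′ h x p with any-elim _ p
  ... | y , q = let z , e = ∧-true q ; z′ , e′ = h y x z e in any-intro _ y (∧-intro z′ e′)

  nbhd-intro : ∀ (E : Graph n m) Z {y x} → Z y ≡ true → E y x ≡ true → nbhd E Z x ≡ true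
  nbhd-intro E Z {y} {x} z e = any-intro (λ y → Z y ∧ E y x) y (∧-intro z e)

  nbhd-elim : ∀ (E : Graph n m) Z {x} → nbhd E Z x ≡ true → ∃ λ y → Z y ≡ true × E y x ≡ true
  nbhd-elim E Z p = let y , q = any-elim _ p in y , ∧-true q

  Hall-mono : ∀ {E E′ : Graph n m} → (∀ y → E y ⊑ E′ y) → Hall E → Hall E′
  Hall-mono h H Z = ≤-trans (H Z)
    (∑-mono (λ x → 𝟙-mono (nbhd-mono Z Z (λ y x z e → z , h y x e) x)))

  Hall? : ∀ E → Hall E ⊎ ∃ λ Z → ¬ HallAt E Z
  Hall? E = all-or-counterexample (HallAt E) ext (λ Z → demand Z ≤? ∑ (𝟙 ∘ nbhd E Z))
    where
    ext : Extensional (HallAt E)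
    ext {Z} {Z′} e H = begin
      demand Z′            ≡⟨ ∑-cong (λ y → cong (λ z → 𝟙 (z ∧ P y)) (sym (e y))) ⟩
      demand Z             ≤⟨ H ⟩
      ∑ (𝟙 ∘ nbhd E Z)     ≤⟨ ∑-mono (λ x → 𝟙-mono (nbhd-mono {E} {E} Z Z′ (λ y x z q → trans (sym (e y)) z , q) x)) ⟩
      ∑ (𝟙 ∘ nbhd E Z′)    ∎
      where open ≤-Reasoning

  restrict : Graph n m → Vec Bool n → (Vec Bool m → Bool) → Graph n m
  restrict E v Q y x = E y x ∧ (not (eqᵇ v y) ∨ Q x)

  restrict-⊑ : ∀ E v Q y → restrict E v Q y ⊑ E y
  restrict-⊑ E v Q y x h = proj₁ (∧-true h)

  restrict-at : ∀ E v Q {x} → restrict E v Q v x ≡ true → Q x ≡ true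
  restrict-at E v Q h with ∨-true {not (eqᵇ v v)} (proj₂ (∧-true {E v _} h))
  ... | inj₂ q = q
  ... | inj₁ p with () ← trans (sym p) (cong not (eqᵇ-refl v))

  restrict-away : ∀ E v Q {y x} → E y x ≡ true → eqᵇ v y ≡ false → restrict E v Q y x ≡ true
  restrict-away E v Q e d rewrite d = ∧-intro e refl

  -- Rado's argument: violators Z₁ and Z₂ of the two restricted graphs both
  -- contain v, and by submodularity the Hall condition for Z₁ ∪ Z₂ and
  -- (Z₁ ∩ Z₂) ∖ {v} in E contradicts the two violations.
  restrict-prime : ∀ {E} v Q R → Hall (restrict E v (λ x → Q x ∨ R x)) →
    Hall (restrict E v Q) ⊎ Hall (restrict E v R)
  restrict-prime {E} v Q R H with Hall? (restrict E v Q) | Hall? (restrict E v R)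
  ... | inj₁ h        | _             = inj₁ h
  ... | inj₂ _        | inj₁ h        = inj₂ h
  ... | inj₂ (Z₁ , f₁) | inj₂ (Z₂ , f₂) = ⊥-elim (<⇒≱ strict (≤-trans lower (≤-trans (+-mono-≤ (H Zᵤ) (H Zᵢ)) upper)))
    where
    E∪ E₁ E₂ : Graph n m
    E∪ = restrict E v (λ x → Q x ∨ R x)
    E₁ = restrict E v Q
    E₂ = restrict E v R
    Zᵤ Zᵢ : Vec Bool n → Bool
    Zᵤ y = Z₁ y ∨ Z₂ y
    Zᵢ y = (Z₁ y ∧ Z₂ y) ∧ not (eqᵇ v y)
    N₁ N₂ : ℕ
    N₁ = ∑ (𝟙 ∘ nbhd E₁ Z₁)
    N₂ = ∑ (𝟙 ∘ nbhd E₂ Z₂)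
    -- Away from `v` the restricted graphs coincide, so a violator that misses `v` would also
    -- violate `H`.
    contains-v : ∀ Z S → ¬ HallAt (restrict E v S) Z → Z v ≡ true
    contains-v Z S f with Z v in e
    ... | true  = refl
    ... | false = contradiction (≤-trans (H Z) (∑-mono (λ x → 𝟙-mono (nbhd-mono Z Z away x)))) f
      where
      away : ∀ y x → Z y ≡ true → E∪ y x ≡ true → Z y ≡ true × restrict E v S y x ≡ true
      away y x z q with eqᵇ v y in d
      ... | false = z , ∧-intro (proj₁ (∧-true q)) refl
      ... | true  rewrite eqᵇ-sound {x = v} {y} d with () ← trans (sym e) z
    v₁ : Z₁ v ≡ true
    v₁ = contains-v Z₁ Q f₁
    v₂ : Z₂ v ≡ true
    v₂ = contains-v Z₂ R f₂
    -- An edge of `E∪` at `v` ends in `Q` or in `R` and survives in `E₁` or `E₂` accordingly; both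
    -- violators contain `v`.
    union : ∀ x → nbhd E∪ Zᵤ x ≡ true → nbhd E₁ Z₁ x ∨ nbhd E₂ Z₂ x ≡ true
    union x p with nbhd-elim E∪ Zᵤ p
    ... | y , z , e with eqᵇ v y in d
    ... | true rewrite sym (eqᵇ-sound {x = v} {y} d)
      with ∨-true {Q x} (proj₂ (∧-true {E v x} e))
    ... | inj₁ q = ∨-introˡ (nbhd-intro E₁ Z₁ v₁ (∧-intro (proj₁ (∧-true e)) (∨-introʳ {not (eqᵇ v v)} q)))
    ... | inj₂ r = ∨-introʳ {nbhd E₁ Z₁ x} (nbhd-intro E₂ Z₂ v₂ (∧-intro (proj₁ (∧-true e)) (∨-introʳ {not (eqᵇ v v)} r)))
    union x p | y , z , e | false with ∨-true {Z₁ y} z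
    ... | inj₁ z₁ = ∨-introˡ (nbhd-intro E₁ Z₁ z₁ (restrict-away E v Q (proj₁ (∧-true e)) d))
    ... | inj₂ z₂ = ∨-introʳ {nbhd E₁ Z₁ x} (nbhd-intro E₂ Z₂ z₂ (restrict-away E v R (proj₁ (∧-true e)) d))
    -- Here the exclusion of `v` from `Zᵢ` matters: an edge at `v` need not survive in both graphs,
    -- while all other edges do.
    intersection : ∀ x → nbhd E∪ Zᵢ x ≡ true → nbhd E₁ Z₁ x ∧ nbhd E₂ Z₂ x ≡ true
    intersection x p with nbhd-elim E∪ Zᵢ p
    ... | y , z , e with eqᵇ v y in d
    ... | true  with () ← proj₂ (∧-true {Z₁ y ∧ Z₂ y} z)
    ... | false = let z₁ , z₂ = ∧-true (proj₁ (∧-true {Z₁ y ∧ Z₂ y} z)) ; e′ = proj₁ (∧-true e) in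
      ∧-intro (nbhd-intro E₁ Z₁ z₁ (restrict-away E v Q e′ d)) (nbhd-intro E₂ Z₂ z₂ (restrict-away E v R e′ d))
    modular : ∀ {u i a b} → (u ≡ true → a ∨ b ≡ true) → (i ≡ true → a ∧ b ≡ true) → 𝟙 u + 𝟙 i ≤ 𝟙 a + 𝟙 b
    modular {u} {i} {true}  {true}  f g = +-mono-≤ (𝟙≤1 u) (𝟙≤1 i)
    modular {u} {i} {true}  {false} f g = +-mono-≤ (𝟙≤1 u) (𝟙-mono {i} g)
    modular {u} {i} {false} {true}  f g = subst (_≤ 1) (+-comm (𝟙 i) (𝟙 u)) (+-mono-≤ (𝟙-mono {i} {false} g) (𝟙≤1 u))
    modular {u} {i} {false} {false} f g = +-mono-≤ (𝟙-mono {u} f) (𝟙-mono {i} g)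
    upper : ∑ (𝟙 ∘ nbhd E∪ Zᵤ) + ∑ (𝟙 ∘ nbhd E∪ Zᵢ) ≤ N₁ + N₂
    upper = begin
      ∑ (𝟙 ∘ nbhd E∪ Zᵤ) + ∑ (𝟙 ∘ nbhd E∪ Zᵢ)          ≡⟨ sym (∑-+ (𝟙 ∘ nbhd E∪ Zᵤ) _) ⟩
      ∑ (λ x → 𝟙 (nbhd E∪ Zᵤ x) + 𝟙 (nbhd E∪ Zᵢ x))    ≤⟨ ∑-mono (λ x → modular {a = nbhd E₁ Z₁ x} {nbhd E₂ Z₂ x} (union x) (intersection x)) ⟩
      ∑ (λ x → 𝟙 (nbhd E₁ Z₁ x) + 𝟙 (nbhd E₂ Z₂ x))    ≡⟨ ∑-+ (𝟙 ∘ nbhd E₁ Z₁) _ ⟩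
      N₁ + N₂                                          ∎
      where open ≤-Reasoning
    -- Compared with the full intersection at most the point `v` is lost, and `𝟙 e` pays for it.
    demand-modular : ∀ a b e p → 𝟙 (a ∧ p) + 𝟙 (b ∧ p) ≤ (𝟙 ((a ∨ b) ∧ p) + 𝟙 (((a ∧ b) ∧ not e) ∧ p)) + 𝟙 e
    demand-modular false b     e     p     = ≤-trans (m≤m+n _ 0) (m≤m+n _ _)
    demand-modular true  b     e     false = ≤-trans (≤-reflexive (cong 𝟙 (∧-zeroʳ b))) z≤n
    demand-modular true  false e     true  = s≤s z≤n
    demand-modular true  true  false true  = ≤-refl
    demand-modular true  true  true  true  = ≤-refl
    demands : demand Z₁ + demand Z₂ ≤ (demand Zᵤ + demand Zᵢ) + 1
    demands = begin
      demand Z₁ + demand Z₂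
        ≡⟨ sym (∑-+ (λ y → 𝟙 (Z₁ y ∧ P y)) _) ⟩
      ∑ (λ y → 𝟙 (Z₁ y ∧ P y) + 𝟙 (Z₂ y ∧ P y))
        ≤⟨ ∑-mono (λ y → demand-modular (Z₁ y) (Z₂ y) (eqᵇ v y) (P y)) ⟩
      ∑ (λ y → (𝟙 (Zᵤ y ∧ P y) + 𝟙 (Zᵢ y ∧ P y)) + 𝟙 (eqᵇ v y))
        ≡⟨ ∑-+ (λ y → 𝟙 (Zᵤ y ∧ P y) + 𝟙 (Zᵢ y ∧ P y)) _ ⟩
      ∑ (λ y → 𝟙 (Zᵤ y ∧ P y) + 𝟙 (Zᵢ y ∧ P y)) + ∑ (λ y → 𝟙 (eqᵇ v y))
        ≡⟨ cong₂ _+_ (∑-+ (λ y → 𝟙 (Zᵤ y ∧ P y)) _) (∑-𝟙-eqᵇ v) ⟩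
      (demand Zᵤ + demand Zᵢ) + 1 ∎
      where open ≤-Reasoning
    lower : demand Z₁ + demand Z₂ ∸ 1 ≤ demand Zᵤ + demand Zᵢ
    lower = m≤n+o⇒m∸n≤o (demand Z₁ + demand Z₂) 1 (≤-trans demands (≤-reflexive (+-comm _ 1)))
    -- The two violations give a surplus of two, and removing `v` uses up only one of it.
    strict : N₁ + N₂ < demand Z₁ + demand Z₂ ∸ 1
    strict = m+n≤o⇒m≤o∸n (suc (N₁ + N₂)) (subst (_≤ demand Z₁ + demand Z₂) (shape N₁ N₂) (+-mono-≤ (≰⇒> f₁) (≰⇒> f₂)))
      where
      shape : ∀ a b → suc a + suc b ≡ suc (a + b) + 1
      shape = solve-∀

  -- The property `Hall (restrict E v Q)` is monotone and prime in `Q` and holds for the full set,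
  -- so `prime⇒singleton` shrinks `Q` to one point.
  choose : ∀ {E} v → Hall E → ∃ λ x → Hall (restrict E v (eqᵇ x))
  choose {E} v H = prime⇒singleton (λ Q → Hall (restrict E v Q))
    (λ {Q} {R} Q⊑R → Hall-mono (λ y x h → let e , q = ∧-true h in ∧-intro e (weaken {not (eqᵇ v y)} (Q⊑R x) q)))
    (λ {Q} {R} → restrict-prime v Q R)
    (Hall-mono (λ y x e → ∧-intro e (∨-introʳ {not (eqᵇ v y)} refl)) H)
    where
    weaken : ∀ {c a b} → (a ≡ true → b ≡ true) → c ∨ a ≡ true → c ∨ b ≡ true
    weaken {true}  h p = refl
    weaken {false} h p = h p

  -- At most one neighbour: `x` is an arbitrary value if `v` has none. For points of `P` existence
  -- follows from Hall's condition in `marriage`.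
  Functional : Graph n m → Vec Bool n → Set
  Functional E v = ∃ λ x → ∀ {x′} → E v x′ ≡ true → x ≡ x′

  -- Later choices only delete edges, so vertices treated earlier remain functional.
  choose-all : ∀ E → Hall E → ∀ vs →
    ∃ λ E′ → Hall E′ × (∀ y → E′ y ⊑ E y) × (∀ {v} → v ∈ vs → Functional E′ v)
  choose-all E H []ˡ       = E , H , (λ y x e → e) , λ ()
  choose-all E H (v ∷ˡ vs) with choose v H
  ... | x , Hx with choose-all (restrict E v (eqᵇ x)) Hx vs
  ... | E′ , H′ , sub , fun = E′ , H′ , (λ y z e → restrict-⊑ E v (eqᵇ x) y z (sub y z e)) , λ where
    (here refl) → x , λ {x′} e → eqᵇ-sound (restrict-at E v (eqᵇ x) (sub v x′ e))
    (there i)   → fun i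

  record Matching (E : Graph n m) : Set where
    field
      partner    : Vec Bool n → Vec Bool m
      edge       : ∀ y → P y ≡ true → E y (partner y) ≡ true
      injective  : ∀ {y y′} → P y ≡ true → P y′ ≡ true → partner y ≡ partner y′ → y ≡ y′
      surjective : ∑ (𝟙 ∘ P) ≡ 2 ^ m → ∀ x → ∃ λ y → P y ≡ true × partner y ≡ x

  -- Once every vertex has at most one neighbour, Hall's condition for singletons yields the edges,
  -- for pairs injectivity, and for all of `P` surjectivity.
  marriage : ∀ E → Hall E → Matching E
  marriage E H with choose-all E H (allVecs n)
  ... | E′ , H′ , sub , fun = record
    { partner = g ; edge = edge ; injective = injective ; surjective = surjective }
    where
    g : Vec Bool n → Vec Bool m
    g y = proj₁ (fun (∈-allVecs y))
    g-unique : ∀ {y x} → E′ y x ≡ true → g y ≡ x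
    g-unique {y} = proj₂ (fun (∈-allVecs y))
    edge : ∀ y → P y ≡ true → E y (g y) ≡ true
    edge y p with ∑-𝟙-nonempty (nbhd E′ (eqᵇ y)) (≤-trans (≤-reflexive (sym (∑-𝟙-eqᵇ y)))
                   (≤-trans (∑-mono {n} (λ z → 𝟙-mono (λ e → ∧-intro e (subst (λ z → P z ≡ true) (eqᵇ-sound {x = y} {z} e) p))))
                     (H′ (eqᵇ y))))
    ... | x , q with nbhd-elim E′ (eqᵇ y) q
    ... | z , y≈z , e rewrite sym (eqᵇ-sound {x = y} {z} y≈z) = subst (λ x → E y x ≡ true) (sym (g-unique e)) (sub y x e)
    injective : ∀ {y y′} → P y ≡ true → P y′ ≡ true → g y ≡ g y′ → y ≡ y′
    injective {y} {y′} p p′ gy≡gy′ with eqᵇ y y′ in d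
    ... | true  = eqᵇ-sound d
    ... | false = contradiction two (<⇒≱ {1} ≤-refl)
      where
      Z : Vec Bool n → Bool
      Z z = eqᵇ y z ∨ eqᵇ y′ z
      pointwise : ∀ z → 𝟙 (eqᵇ y z) + 𝟙 (eqᵇ y′ z) ≤ 𝟙 (Z z ∧ P z)
      pointwise z with eqᵇ y z in e | eqᵇ y′ z in e′
      ... | false | false = z≤n
      ... | true  | false rewrite sym (eqᵇ-sound {x = y} {z} e) | p = ≤-refl
      ... | false | true  rewrite sym (eqᵇ-sound {x = y′} {z} e′) | p′ = ≤-refl
      ... | true  | true  rewrite sym (eqᵇ-sound {x = y′} {z} e′) with () ← trans (sym d) e
      one-image : nbhd E′ Z ⊑ eqᵇ (g y)
      one-image x q with nbhd-elim E′ Z q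
      ... | z , h , e with ∨-true {eqᵇ y z} h
      ... | inj₁ a rewrite eqᵇ-sound {x = y} {z} a | g-unique e = eqᵇ-refl x
      ... | inj₂ b rewrite eqᵇ-sound {x = y′} {z} b | gy≡gy′ | g-unique e = eqᵇ-refl x
      two : 2 ≤ 1
      two = begin
        2                                            ≡⟨ cong₂ _+_ (sym (∑-𝟙-eqᵇ y)) (sym (∑-𝟙-eqᵇ y′)) ⟩
        ∑ (𝟙 ∘ eqᵇ y) + ∑ (𝟙 ∘ eqᵇ y′)               ≡⟨ sym (∑-+ (𝟙 ∘ eqᵇ y) _) ⟩
        ∑ (λ z → 𝟙 (eqᵇ y z) + 𝟙 (eqᵇ y′ z))         ≤⟨ ∑-mono pointwise ⟩
        demand Z                                     ≤⟨ H′ Z ⟩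
        ∑ (𝟙 ∘ nbhd E′ Z)                            ≤⟨ ∑-mono (λ x → 𝟙-mono (one-image x)) ⟩
        ∑ (𝟙 ∘ eqᵇ (g y))                            ≡⟨ ∑-𝟙-eqᵇ (g y) ⟩
        1                                            ∎
        where open ≤-Reasoning
    surjective : ∑ (𝟙 ∘ P) ≡ 2 ^ m → ∀ x → ∃ λ y → P y ≡ true × g y ≡ x
    surjective size x with nbhd-elim E′ P (∑-𝟙-full (nbhd E′ P) (≤-trans (≤-reflexive (sym size))
                             (≤-trans (∑-mono {n} (λ y → 𝟙-mono {P y} (λ p → ∧-intro p p))) (H′ P))) x)
    ... | y , p , e = y , p , g-unique e

-- `V` is a fractional matching with common denominator `D`. If `Z` contains a point of `P` outside
-- `T`, its neighbourhood is everything. Otherwise count the weight in two ways: each point of `Z`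
-- in `P` emits at least `D`, all of it lands in the neighbourhood, and each point there absorbs at
-- most `D`.
fractional⇒Hall : ∀ {n m} (P T : Vec Bool n → Bool) (E : Graph n m)
  (V : Vec Bool n → Vec Bool m → ℕ) (D : ℕ) .{{_ : NonZero D}} →
  ∑ (𝟙 ∘ P) ≤ 2 ^ m →
  (∀ y → T y ≡ false → ∀ x → E y x ≡ true) →
  (∀ y → T y ≡ true → D ≤ ∑ (V y)) →
  (∀ x → ∑ (λ y → V y x) ≤ D) →
  (∀ y x → E y x ≡ false → V y x ≡ 0) →
  Marriage.Hall P E
fractional⇒Hall {n} {m} P T E V D size joker row col support Z
  with any (λ y → (Z y ∧ P y) ∧ not (T y)) in has-joker
... | true = begin
  ∑ (λ y → 𝟙 (Z y ∧ P y))    ≤⟨ ∑-mono {n} (λ y → 𝟙-mono {Z y ∧ P y} (proj₂ ∘ ∧-true {Z y})) ⟩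
  ∑ (𝟙 ∘ P)                  ≤⟨ size ⟩
  2 ^ m                      ≡⟨ sym (∑-1 m) ⟩
  ∑ {m} (λ _ → 1)            ≡⟨ ∑-cong {m} (λ x → cong 𝟙 (sym (everything x))) ⟩
  ∑ (𝟙 ∘ nbhd E Z)           ∎
  where
  open ≤-Reasoning
  everything : ∀ x → nbhd E Z x ≡ true
  everything x with any-elim (λ y → (Z y ∧ P y) ∧ not (T y)) has-joker
  ... | y , q with T y in t
  ... | true  = contradiction (proj₂ (∧-true {Z y ∧ P y} q)) λ ()
  ... | false = Marriage.nbhd-intro P E Z {y} (proj₁ (∧-true (proj₁ (∧-true {Z y ∧ P y} q)))) (joker y t x)
... | false = *-cancelʳ-≤ _ _ D (begin
  ∑ (λ y → 𝟙 (Z y ∧ P y)) * D                          ≡⟨ sym (∑-*ʳ (λ y → 𝟙 (Z y ∧ P y)) D) ⟩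
  ∑ (λ y → 𝟙 (Z y ∧ P y) * D)                          ≤⟨ ∑-mono saturated ⟩
  ∑ (λ y → 𝟙 (Z y ∧ P y) * ∑ (V y))                    ≡⟨ ∑-cong (λ y → sym (∑-*ˡ (𝟙 (Z y ∧ P y)) (V y))) ⟩
  ∑ (λ y → ∑ (λ x → 𝟙 (Z y ∧ P y) * V y x))            ≡⟨ ∑-swap (λ y x → 𝟙 (Z y ∧ P y) * V y x) ⟩
  ∑ (λ x → ∑ (λ y → 𝟙 (Z y ∧ P y) * V y x))            ≤⟨ ∑-mono (λ x → ∑-mono (λ y → local y x)) ⟩
  ∑ (λ x → ∑ (λ y → 𝟙 (nbhd E Z x) * V y x))           ≡⟨ ∑-cong (λ x → ∑-*ˡ (𝟙 (nbhd E Z x)) (λ y → V y x)) ⟩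
  ∑ (λ x → 𝟙 (nbhd E Z x) * ∑ (λ y → V y x))           ≤⟨ ∑-mono (λ x → *-monoʳ-≤ (𝟙 (nbhd E Z x)) (col x)) ⟩
  ∑ (λ x → 𝟙 (nbhd E Z x) * D)                         ≡⟨ ∑-*ʳ (𝟙 ∘ nbhd E Z) D ⟩
  ∑ (𝟙 ∘ nbhd E Z) * D                                 ∎)
  where
  open ≤-Reasoning
  saturated : ∀ y → 𝟙 (Z y ∧ P y) * D ≤ 𝟙 (Z y ∧ P y) * ∑ (V y)
  saturated y with T y in t | Z y ∧ P y in zp
  ... | true  | b     = *-monoʳ-≤ (𝟙 b) (row y t)
  ... | false | false = z≤n
  ... | false | true  with () ← trans (sym has-joker)
    (any-intro (λ y → (Z y ∧ P y) ∧ not (T y)) y (∧-intro zp (cong not t)))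
  local : ∀ y x → 𝟙 (Z y ∧ P y) * V y x ≤ 𝟙 (nbhd E Z x) * V y x
  local y x with E y x in e
  ... | true  = *-monoˡ-≤ (V y x) (𝟙-mono {Z y ∧ P y} (λ q → Marriage.nbhd-intro P E Z {y} (proj₁ (∧-true q)) e))
  ... | false rewrite support y x e | *-zeroʳ (𝟙 (Z y ∧ P y)) = z≤n

-- Sums along injections

∑-𝟙-unique : ∀ {n} (Q : Vec Bool n → Bool) → (∀ {x x′} → Q x ≡ true → Q x′ ≡ true → x ≡ x′) → ∑ (𝟙 ∘ Q) ≤ 1
∑-𝟙-unique {n} Q unique with any Q in e
... | true  = let x , q = any-elim Q e in ≤-trans
  (∑-mono {n} (λ x′ → 𝟙-mono {Q x′} {eqᵇ x x′} (λ q′ → subst (λ z → eqᵇ x z ≡ true) (unique q q′) (eqᵇ-refl x))))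
  (≤-reflexive (∑-𝟙-eqᵇ x))
... | false = ≤-trans (∑-mono {n} (λ x → 𝟙-mono {Q x} {false} (λ q → trans (sym e) (any-intro Q x q))))
  (≤-trans (≤-reflexive (∑-0 n)) z≤n)

-- Inserting the delta function `eqᵇ (f x) y` and swapping the sums leaves the size of the fibre
-- over `y`, at most 1, as the coefficient of `g y`.
∑-inject : ∀ {n m} (f : Vec Bool m → Vec Bool n) (g : Vec Bool n → ℕ) →
  (∀ {x x′} → f x ≡ f x′ → x ≡ x′) → ∑ (g ∘ f) ≤ ∑ g
∑-inject f g inj = begin
  ∑ (g ∘ f)                                      ≡⟨ ∑-cong (λ x → sym (∑-eqᵇ (f x) g)) ⟩
  ∑ (λ x → ∑ (λ y → 𝟙 (eqᵇ (f x) y) * g y))      ≡⟨ ∑-swap (λ x y → 𝟙 (eqᵇ (f x) y) * g y) ⟩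
  ∑ (λ y → ∑ (λ x → 𝟙 (eqᵇ (f x) y) * g y))      ≡⟨ ∑-cong (λ y → ∑-*ʳ (λ x → 𝟙 (eqᵇ (f x) y)) (g y)) ⟩
  ∑ (λ y → ∑ (λ x → 𝟙 (eqᵇ (f x) y)) * g y)
    ≤⟨ ∑-mono (λ y → *-monoˡ-≤ (g y) (∑-𝟙-unique (λ x → eqᵇ (f x) y)
         (λ {x} {x′} p q → inj (trans (eqᵇ-sound {x = f x} p) (sym (eqᵇ-sound {x = f x′} q)))))) ⟩
  ∑ (λ y → 1 * g y)                              ≡⟨ ∑-cong (λ y → *-identityˡ (g y)) ⟩
  ∑ g                                            ∎
  where open ≤-Reasoning

-- Hamming distance

δ : Bool → Bool → ℕ
δ a b = 𝟙 (a xor b)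

δ-triangle : ∀ a b c → δ a c ≤ δ a b + δ b c
δ-triangle false false c     = ≤-refl
δ-triangle true  true  c     = ≤-refl
δ-triangle false true  false = z≤n
δ-triangle false true  true  = ≤-refl
δ-triangle true  false false = ≤-refl
δ-triangle true  false true  = z≤n

dist-triangle : ∀ {n} (x y z : Vec Bool n) → dist x z ≤ dist x y + dist y z
dist-triangle []       []       []       = z≤n
dist-triangle (a ∷ x) (b ∷ y) (c ∷ z) = ≤-trans
  (+-mono-≤ (δ-triangle a b c) (dist-triangle x y z))
  (≤-reflexive (+-interchange (δ a b) (δ b c) (dist x y) (dist y z)))

dist-sym : ∀ {n} (x y : Vec Bool n) → dist x y ≡ dist y x
dist-sym []          []          = refl
dist-sym (false ∷ x) (false ∷ y) = dist-sym x y
dist-sym (false ∷ x) (true ∷ y)  = cong suc (dist-sym x y)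
dist-sym (true ∷ x)  (false ∷ y) = cong suc (dist-sym x y)
dist-sym (true ∷ x)  (true ∷ y)  = dist-sym x y

dist-refl : ∀ {n} (x : Vec Bool n) → dist x x ≡ 0
dist-refl []          = refl
dist-refl (false ∷ x) = dist-refl x
dist-refl (true ∷ x)  = dist-refl x

dist≤n : ∀ {n} (x y : Vec Bool n) → dist x y ≤ n
dist≤n []       []       = z≤n
dist≤n (a ∷ x) (b ∷ y) = +-mono-≤ (𝟙≤1 (a xor b)) (dist≤n x y)

dist-split : ∀ w {n} (x y : Vec Bool (w + n)) →
  dist x y ≡ dist (take w x) (take w y) + dist (drop w x) (drop w y)
dist-split zero    x        y        = refl
dist-split (suc w) (a ∷ x) (b ∷ y) = trans (cong (δ a b +_) (dist-split w x y)) (sym (+-assoc (δ a b) _ _))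

dist-∷ʳ : ∀ {n} (x : Vec Bool n) a b → dist (x ∷ʳ a) (x ∷ʳ b) ≤ 1
dist-∷ʳ []          a b = subst (_≤ 1) (sym (+-identityʳ (δ a b))) (𝟙≤1 (a xor b))
dist-∷ʳ (false ∷ x) a b = dist-∷ʳ x a b
dist-∷ʳ (true ∷ x)  a b = dist-∷ʳ x a b

dist-embed-flipAt : ∀ {m} (x : Vec Bool m) i → dist (embed x) (embed (flipAt x i)) ≡ 1
dist-embed-flipAt (false ∷ x) zero    = cong suc (dist-refl (embed x))
dist-embed-flipAt (true ∷ x)  zero    = cong suc (dist-refl (embed x))
dist-embed-flipAt (false ∷ x) (suc i) = dist-embed-flipAt x i
dist-embed-flipAt (true ∷ x)  (suc i) = dist-embed-flipAt x i

-- Stretch in terms of displacement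

∑-flipAt : ∀ {m} (f : Vec Bool m → ℕ) i → ∑ (λ x → f (flipAt x i)) ≡ ∑ f
∑-flipAt f zero    = +-comm (∑ (f ∘ (true ∷_))) _
∑-flipAt f (suc i) = cong₂ _+_ (∑-flipAt (f ∘ (false ∷_)) i) (∑-flipAt (f ∘ (true ∷_)) i)

∑-sum-swap : ∀ {n} {A : Set} (f : Vec Bool n → A → ℕ) l →
  ∑ (λ x → sum (map (f x) l)) ≡ sum (map (λ i → ∑ (λ x → f x i)) l)
∑-sum-swap {n} f []ˡ      = ∑-0 n
∑-sum-swap     f (i ∷ˡ l) = trans (∑-+ (λ x → f x i) (λ x → sum (map (f x) l)))
  (cong (∑ (λ x → f x i) +_) (∑-sum-swap f l))

sum-map≤ : ∀ {A : Set} (f : A → ℕ) b → (∀ i → f i ≤ b) → ∀ l → sum (map f l) ≤ length l * b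
sum-map≤ f b h []ˡ      = z≤n
sum-map≤ f b h (i ∷ˡ l) = +-mono-≤ (h i) (sum-map≤ f b h l)

-- The detour through `embed x` and `embed x′` costs two displacements and one flip. Flipping a
-- fixed coordinate permutes the cube, so both displacements sum to the same total.
totalStretch≤ : ∀ {m} {P : Vec Bool (suc m) → Bool} (φ : Vec Bool m → Σ (Vec Bool (suc m)) (λ y → P y ≡ true)) →
  totalStretch φ ≤ m * (2 * totalDisplacement φ + 2 ^ m)
totalStretch≤ {m} φ = begin
  totalStretch φ
    ≡⟨ ∑-allVecs (λ x → sum (map (stretch x) (allFin m))) ⟩
  ∑ (λ x → sum (map (stretch x) (allFin m)))
    ≡⟨ ∑-sum-swap stretch (allFin m) ⟩
  sum (map (λ i → ∑ (λ x → stretch x i)) (allFin m))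
    ≤⟨ sum-map≤ _ _ direction (allFin m) ⟩
  length (allFin m) * (2 * totalDisplacement φ + 2 ^ m)
    ≡⟨ cong (_* (2 * totalDisplacement φ + 2 ^ m)) (length-tabulate {n = m} id) ⟩
  m * (2 * totalDisplacement φ + 2 ^ m) ∎
  where
  open ≤-Reasoning
  stretch : Vec Bool m → Fin m → ℕ
  stretch x i = dist (proj₁ (φ x)) (proj₁ (φ (flipAt x i)))
  d : Vec Bool m → ℕ
  d x = dist (embed x) (proj₁ (φ x))
  detour : ∀ x i → stretch x i ≤ (d x + d (flipAt x i)) + 1
  detour x i = begin
    stretch x i
      ≤⟨ dist-triangle (proj₁ (φ x)) (embed x) (proj₁ (φ x′)) ⟩
    dist (proj₁ (φ x)) (embed x) + dist (embed x) (proj₁ (φ x′))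
      ≤⟨ +-mono-≤ (≤-reflexive (dist-sym (proj₁ (φ x)) (embed x))) (dist-triangle (embed x) (embed x′) (proj₁ (φ x′))) ⟩
    d x + (dist (embed x) (embed x′) + d x′)
      ≡⟨ cong (λ e → d x + (e + d x′)) (dist-embed-flipAt x i) ⟩
    d x + (1 + d x′)
      ≡⟨ shape (d x) (d x′) ⟩
    (d x + d x′) + 1 ∎
    where
    x′ : Vec Bool m
    x′ = flipAt x i
    shape : ∀ a b → a + (1 + b) ≡ (a + b) + 1
    shape = solve-∀
  direction : ∀ i → ∑ (λ x → stretch x i) ≤ 2 * totalDisplacement φ + 2 ^ m
  direction i = begin
    ∑ (λ x → stretch x i)                             ≤⟨ ∑-mono (λ x → detour x i) ⟩
    ∑ (λ x → (d x + d (flipAt x i)) + 1)              ≡⟨ ∑-+ (λ x → d x + d (flipAt x i)) (λ _ → 1) ⟩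
    ∑ (λ x → d x + d (flipAt x i)) + ∑ {m} (λ _ → 1)  ≡⟨ cong₂ _+_ (∑-+ d (λ x → d (flipAt x i))) (∑-1 m) ⟩
    (∑ d + ∑ (λ x → d (flipAt x i))) + 2 ^ m          ≡⟨ cong (λ e → (∑ d + e) + 2 ^ m) (trans (∑-flipAt d i) (sym (+-identityʳ (∑ d)))) ⟩
    2 * ∑ d + 2 ^ m                                   ≡⟨ cong (λ e → 2 * e + 2 ^ m) (sym (∑-allVecs d)) ⟩
    2 * totalDisplacement φ + 2 ^ m                   ∎

-- From a transport plan to a bijection

≤ᵇ-true⇒≤ : ∀ {a b} → (a ≤ᵇ b) ≡ true → a ≤ b
≤ᵇ-true⇒≤ {a} {b} h = ≤ᵇ⇒≤ a b (Equivalence.from T-≡ h)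

≤⇒≤ᵇ-true : ∀ {a b} → a ≤ b → (a ≤ᵇ b) ≡ true
≤⇒≤ᵇ-true h = Equivalence.to T-≡ (≤⇒≤ᵇ h)

subset-≡ : ∀ {n} (P : Vec Bool n → Bool) {a b : Σ (Vec Bool n) (λ y → P y ≡ true)} → proj₁ a ≡ proj₁ b → a ≡ b
subset-≡ P {y , p} {.y , q} refl = cong (y ,_) (uip p q)

-- V is a transport plan on the whole cube; its source is then folded onto the
-- half-cube by forgetting the last bit, at the price of one unit of distance.
transport : ∀ {m} (P T : Vec Bool (suc m) → Bool) (c : Vec Bool (suc m) → ℕ)
  (V : Vec Bool (suc m) → Vec Bool (suc m) → ℕ) (M : ℕ) .{{_ : NonZero M}} →
  ∑ (𝟙 ∘ P) ≡ 2 ^ m →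
  (∀ y → T y ≡ true → ∑ (λ u → V u y) ≡ 2 * M) →
  (∀ u → ∑ (V u) ≤ M) →
  (∀ u y → dist u y ≤ c y ⊎ V u y ≡ 0) →
  Σ (Bijection (setoid (Vec Bool m)) (setoid (Σ (Vec Bool (suc m)) (λ y → P y ≡ true))))
    λ φ → ∀ x → let y = proj₁ (Bijection.to φ x) in
      dist (embed x) y ≤ (if T y then suc (c y) else suc m)
transport {m} P T c V M size row col support = φ , bound
  where
  -- In `T` the extra unit pays for the last bit; elsewhere `suc m` bounds every distance, so such a
  -- point is joined to the whole half-cube.
  h : Vec Bool (suc m) → ℕ
  h y = if T y then suc (c y) else suc m
  E : Graph (suc m) m
  E y x = dist (embed x) y ≤ᵇ h y
  -- The two points over `x` are merged, so the capacity of `x` is `2 * M`, which is also the mass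
  -- emitted by each point of `T`.
  V′ : Vec Bool (suc m) → Vec Bool m → ℕ
  V′ y x = V (x ∷ʳ false) y + V (x ∷ʳ true) y
  joker : ∀ y → T y ≡ false → ∀ x → E y x ≡ true
  joker y t x rewrite t = ≤⇒≤ᵇ-true (dist≤n (embed x) y)
  row′ : ∀ y → T y ≡ true → 2 * M ≤ ∑ (V′ y)
  row′ y t = ≤-reflexive (sym (trans (∑-∷ʳ (λ u → V u y)) (row y t)))
  col′ : ∀ x → ∑ (λ y → V′ y x) ≤ 2 * M
  col′ x = begin
    ∑ (λ y → V (x ∷ʳ false) y + V (x ∷ʳ true) y)   ≡⟨ ∑-+ (V (x ∷ʳ false)) (V (x ∷ʳ true)) ⟩
    ∑ (V (x ∷ʳ false)) + ∑ (V (x ∷ʳ true))         ≤⟨ +-mono-≤ (col _) (col _) ⟩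
    M + M                                          ≡⟨ cong (M +_) (sym (+-identityʳ M)) ⟩
    2 * M                                          ∎
    where open ≤-Reasoning
  no-edge : ∀ y x → E y x ≡ false → V′ y x ≡ 0
  no-edge y x e = cong₂ _+_ (vanish false) (vanish true)
    where
    near : ∀ b → dist (x ∷ʳ b) y ≤ c y → dist (embed x) y ≤ h y
    near b p with T y
    ... | false = dist≤n (embed x) y
    ... | true  = ≤-trans (dist-triangle (embed x) (x ∷ʳ b) y) (+-mono-≤ (dist-∷ʳ x false b) p)
    vanish : ∀ b → V (x ∷ʳ b) y ≡ 0
    vanish b with support (x ∷ʳ b) y
    ... | inj₂ v = v
    ... | inj₁ p with () ← trans (sym e) (≤⇒≤ᵇ-true (near b p))
  instance
    2M≢0 : NonZero (2 * M)
    2M≢0 = m*n≢0 2 M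
  open Marriage.Matching (Marriage.marriage P E
    (fractional⇒Hall P T E V′ (2 * M) (≤-reflexive size) joker row′ col′ no-edge))
  -- `P` has as many points as the half-cube, so the matching is onto and can be inverted.
  back : Vec Bool m → Σ (Vec Bool (suc m)) (λ y → P y ≡ true)
  back x = let y , p , _ = surjective size x in y , p
  partner-back : ∀ x → partner (proj₁ (back x)) ≡ x
  partner-back x = proj₂ (proj₂ (surjective size x))
  φ : Bijection (setoid (Vec Bool m)) (setoid (Σ (Vec Bool (suc m)) (λ y → P y ≡ true)))
  φ = record
    { to        = back
    ; cong      = cong back
    ; bijective =
        (λ {x} {x′} e → trans (sym (partner-back x)) (trans (cong (partner ∘ proj₁) e) (partner-back x′)))
      , λ (y , p) → partner y , λ { refl → subset-≡ P (injective (proj₂ (back (partner y))) p (partner-back (partner y))) }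
    }
  bound : ∀ x → dist (embed x) (proj₁ (back x)) ≤ h (proj₁ (back x))
  bound x = subst (λ z → dist (embed z) (proj₁ (back x)) ≤ h (proj₁ (back x))) (partner-back x)
    (≤ᵇ-true⇒≤ (edge (proj₁ (back x)) (proj₂ (back x))))

-- The transport plan for Tribes

eqᵇ-sym : ∀ {n} (x y : Vec Bool n) → eqᵇ x y ≡ eqᵇ y x
eqᵇ-sym []          []          = refl
eqᵇ-sym (false ∷ x) (false ∷ y) = eqᵇ-sym x y
eqᵇ-sym (false ∷ x) (true ∷ y)  = refl
eqᵇ-sym (true ∷ x)  (false ∷ y) = refl
eqᵇ-sym (true ∷ x)  (true ∷ y)  = eqᵇ-sym x y

∑-𝟙-not : ∀ {n} (Q : Vec Bool n → Bool) → ∑ (𝟙 ∘ Q) + ∑ (λ x → 𝟙 (not (Q x))) ≡ 2 ^ n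
∑-𝟙-not {n} Q = trans (sym (∑-+ (𝟙 ∘ Q) (λ x → 𝟙 (not (Q x)))))
  (trans (∑-cong {n} (λ x → complement (Q x))) (∑-1 n))
  where
  complement : ∀ b → 𝟙 b + 𝟙 (not b) ≡ 1
  complement false = refl
  complement true  = refl

∑-allOnes : ∀ w → ∑ (𝟙 ∘ allOnes {w}) ≡ 1
∑-allOnes zero    = refl
∑-allOnes (suc w) = cong₂ _+_ (∑-0 w) (∑-allOnes w)

∑-not-allOnes : ∀ w → ∑ (λ a → 𝟙 (not (allOnes {w} a))) ≡ 2 ^ w ∸ 1
∑-not-allOnes w = sym (cong (_∸ 1)
  (trans (sym (∑-𝟙-not (allOnes {w}))) (cong (_+ ∑ (λ a → 𝟙 (not (allOnes {w} a)))) (∑-allOnes w))))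

∨-false : ∀ {a b} → a ∨ b ≡ false → a ≡ false × b ≡ false
∨-false {false} {false} refl = refl , refl

module Plan (w : ℕ) where

  k : ℕ
  k = 2 ^ w ∸ 1

  2^w≡1+k : 2 ^ w ≡ 1 + k
  2^w≡1+k = sym (m+[n∸m]≡n (m^n>0 2 w))

  -- Product weights moving every block of y that is all ones uniformly onto the
  -- other block values, so that ∑ (λ x → W s x y) does not depend on y.
  ω : Vec Bool w → Vec Bool w → ℕ
  ω a b = 𝟙 (not (allOnes a)) * (𝟙 (allOnes b) + k * 𝟙 (eqᵇ a b))

  -- If `b` is all ones, each of the `k` other values gets weight 1; otherwise weight `k` stays at
  -- `b`.
  ω-row : ∀ b → ∑ (λ a → ω a b) ≡ k
  ω-row b = begin
    ∑ (λ a → ω a b)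
      ≡⟨ ∑-cong (λ a → trans (cong (λ e → 𝟙 (not (allOnes a)) * (𝟙 (allOnes b) + k * 𝟙 e)) (eqᵇ-sym a b))
                             (shape (𝟙 (not (allOnes a))) (𝟙 (allOnes b)) k (𝟙 (eqᵇ b a)))) ⟩
    ∑ (λ a → 𝟙 (allOnes b) * 𝟙 (not (allOnes a)) + k * (𝟙 (eqᵇ b a) * 𝟙 (not (allOnes a))))
      ≡⟨ ∑-+ {w} (λ a → 𝟙 (allOnes b) * 𝟙 (not (allOnes a))) (λ a → k * (𝟙 (eqᵇ b a) * 𝟙 (not (allOnes a)))) ⟩
    ∑ {w} (λ a → 𝟙 (allOnes b) * 𝟙 (not (allOnes a))) + ∑ (λ a → k * (𝟙 (eqᵇ b a) * 𝟙 (not (allOnes a))))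
      ≡⟨ cong₂ _+_ (trans (∑-*ˡ {w} (𝟙 (allOnes b)) (λ a → 𝟙 (not (allOnes a)))) (cong (𝟙 (allOnes b) *_) (∑-not-allOnes w)))
                   (trans (∑-*ˡ {w} k (λ a → 𝟙 (eqᵇ b a) * 𝟙 (not (allOnes a)))) (cong (k *_) (∑-eqᵇ b (λ a → 𝟙 (not (allOnes a)))))) ⟩
    𝟙 (allOnes b) * k + k * 𝟙 (not (allOnes b))
      ≡⟨ total (allOnes b) ⟩
    k ∎
    where
    open ≡-Reasoning
    shape : ∀ p q k e → p * (q + k * e) ≡ q * p + k * (e * p)
    shape = solve-∀
    total : ∀ c → 𝟙 c * k + k * 𝟙 (not c) ≡ k
    total false = *-identityʳ k
    total true  = trans (cong₂ _+_ (*-identityˡ k) (*-zeroʳ k)) (+-identityʳ k)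

  -- A value other than all ones receives 1 from the all-ones block and `k` from itself; all ones
  -- receives nothing.
  ω-col : ∀ a → ∑ (ω a) ≤ 2 ^ w
  ω-col a = begin
    ∑ (ω a)
      ≡⟨ ∑-*ˡ {w} (𝟙 (not (allOnes a))) (λ b → 𝟙 (allOnes b) + k * 𝟙 (eqᵇ a b)) ⟩
    𝟙 (not (allOnes a)) * ∑ (λ b → 𝟙 (allOnes b) + k * 𝟙 (eqᵇ a b))
      ≤⟨ *-monoˡ-≤ _ (𝟙≤1 (not (allOnes a))) ⟩
    1 * ∑ (λ b → 𝟙 (allOnes b) + k * 𝟙 (eqᵇ a b))
      ≡⟨ *-identityˡ _ ⟩
    ∑ (λ b → 𝟙 (allOnes b) + k * 𝟙 (eqᵇ a b))
      ≡⟨ ∑-+ {w} (𝟙 ∘ allOnes) (λ b → k * 𝟙 (eqᵇ a b)) ⟩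
    ∑ (𝟙 ∘ allOnes {w}) + ∑ (λ b → k * 𝟙 (eqᵇ a b))
      ≡⟨ cong₂ _+_ (∑-allOnes w) (trans (∑-*ˡ {w} k (𝟙 ∘ eqᵇ a)) (trans (cong (k *_) (∑-𝟙-eqᵇ a)) (*-identityʳ k))) ⟩
    1 + k
      ≡⟨ sym 2^w≡1+k ⟩
    2 ^ w ∎
    where open ≤-Reasoning

  ω-diagonal : ∀ a → allOnes a ≡ false → ω a a ≡ k
  ω-diagonal a e rewrite e | eqᵇ-refl a = trans (+-identityʳ (k * 1)) (*-identityʳ k)

  ω-allOnes : ∀ a b → allOnes a ≡ true → ω a b ≡ 0
  ω-allOnes a b e rewrite e = refl

  ω-support : ∀ a b → dist a b ≤ 𝟙 (allOnes b) * w ⊎ ω a b ≡ 0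
  ω-support a b with allOnes b | eqᵇ a b in e
  ... | true  | _     = inj₁ (≤-trans (dist≤n a b) (≤-reflexive (sym (*-identityˡ w))))
  ... | false | true  = inj₁ (≤-reflexive (trans (cong (dist a) (sym (eqᵇ-sound {x = a} e))) (dist-refl a)))
  ... | false | false = inj₂ (trans (cong (𝟙 (not (allOnes a)) *_) (*-zeroʳ k)) (*-zeroʳ (𝟙 (not (allOnes a)))))

  W : ∀ s → Vec Bool (s * w) → Vec Bool (s * w) → ℕ
  W zero    x y = 1
  W (suc s) x y = ω (take w x) (take w y) * W s (drop w x) (drop w y)

  stars : ∀ s → Vec Bool (s * w) → ℕ
  stars zero    y = 0
  stars (suc s) y = 𝟙 (allOnes (take w y)) + stars s (drop w y)

  W-row : ∀ s y → ∑ (λ x → W s x y) ≡ k ^ s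
  W-row zero    y = refl
  W-row (suc s) y = trans (∑-split-* w (λ a → ω a (take w y)) (λ x → W s x (drop w y)))
    (cong₂ _*_ (ω-row (take w y)) (W-row s (drop w y)))

  W-col : ∀ s x → ∑ (W s x) ≤ (2 ^ w) ^ s
  W-col zero    x = ≤-refl
  W-col (suc s) x = ≤-trans
    (≤-reflexive (∑-split-* w (ω (take w x)) (W s (drop w x))))
    (*-mono-≤ (ω-col (take w x)) (W-col s (drop w x)))

  W-diagonal : ∀ s x → tribes w s x ≡ false → W s x x ≡ k ^ s
  W-diagonal zero    x t = refl
  W-diagonal (suc s) x t = let e , t′ = ∨-false t in
    cong₂ _*_ (ω-diagonal (take w x) e) (W-diagonal s (drop w x) t′)

  W-tribes : ∀ s x y → tribes w s x ≡ true → W s x y ≡ 0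
  W-tribes (suc s) x y t with ∨-true {allOnes (take w x)} t
  ... | inj₁ e = cong (_* W s (drop w x) (drop w y)) (ω-allOnes (take w x) (take w y) e)
  ... | inj₂ e = trans (cong (ω (take w x) (take w y) *_) (W-tribes s (drop w x) (drop w y) e))
                       (*-zeroʳ (ω (take w x) (take w y)))

  -- Only the all-ones blocks of `y` move, each by at most `w`.
  W-support : ∀ s x y → dist x y ≤ stars s y * w ⊎ W s x y ≡ 0
  W-support zero    [] [] = inj₁ z≤n
  W-support (suc s) x  y with ω-support (take w x) (take w y) | W-support s (drop w x) (drop w y)
  ... | inj₂ e | _      = inj₂ (cong (_* W s (drop w x) (drop w y)) e)
  ... | inj₁ _ | inj₂ e = inj₂ (trans (cong (ω (take w x) (take w y) *_) e) (*-zeroʳ (ω (take w x) (take w y))))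
  ... | inj₁ p | inj₁ q = inj₁ (begin
    dist x y                                                     ≡⟨ dist-split w x y ⟩
    dist (take w x) (take w y) + dist (drop w x) (drop w y)      ≤⟨ +-mono-≤ p q ⟩
    𝟙 (allOnes (take w y)) * w + stars s (drop w y) * w          ≡⟨ sym (*-distribʳ-+ w (𝟙 (allOnes (take w y))) _) ⟩
    stars (suc s) y * w                                          ∎)
    where open ≤-Reasoning

  -- With denominators cleared: the expected number of all-ones blocks is `s / 2 ^ w`.
  ∑-stars : ∀ s → ∑ (stars s) * 2 ^ w ≡ s * 2 ^ (s * w)
  ∑-stars zero    = refl
  ∑-stars (suc s) = begin
    ∑ (stars (suc s)) * K
      ≡⟨ cong (_* K) (trans (∑-split w (λ a y → 𝟙 (allOnes a) + stars s y))
           (trans (∑-cong {w} (λ a → ∑-+ (λ _ → 𝟙 (allOnes a)) (stars s)))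
                  (∑-+ {w} (λ a → ∑ {s * w} (λ _ → 𝟙 (allOnes a))) (λ _ → ∑ (stars s))))) ⟩
    (∑ {w} (λ a → ∑ {s * w} (λ _ → 𝟙 (allOnes a))) + ∑ {w} (λ _ → ∑ (stars s))) * K
      ≡⟨ cong (_* K) (cong₂ _+_
           (trans (∑-cong {w} (λ a → ∑-const (s * w) (𝟙 (allOnes a))))
             (trans (∑-*ˡ (2 ^ (s * w)) (𝟙 ∘ allOnes {w})) (cong (2 ^ (s * w) *_) (∑-allOnes w))))
           (∑-const w (∑ (stars s)))) ⟩
    (2 ^ (s * w) * 1 + K * ∑ (stars s)) * K
      ≡⟨ shape (2 ^ (s * w)) K (∑ (stars s)) ⟩
    K * 2 ^ (s * w) + K * (∑ (stars s) * K)
      ≡⟨ cong (λ e → K * 2 ^ (s * w) + K * e) (∑-stars s) ⟩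
    K * 2 ^ (s * w) + K * (s * 2 ^ (s * w))
      ≡⟨ factor K (2 ^ (s * w)) s ⟩
    suc s * (K * 2 ^ (s * w))
      ≡⟨ cong (suc s *_) (sym (^-distribˡ-+-* 2 w (s * w))) ⟩
    suc s * 2 ^ (w + s * w) ∎
    where
    open ≡-Reasoning
    K : ℕ
    K = 2 ^ w
    shape : ∀ a K b → (a * 1 + K * b) * K ≡ K * a + K * (b * K)
    shape = solve-∀
    factor : ∀ K a s → K * a + K * (s * a) ≡ (1 + s) * (K * a)
    factor = solve-∀

  -- In a zero of Tribes each of the `s` blocks independently takes one of `k` values.
  ∑-not-tribes : ∀ s → ∑ (λ x → 𝟙 (not (tribes w s x))) ≡ k ^ s
  ∑-not-tribes zero    = refl
  ∑-not-tribes (suc s) = trans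
    (∑-cong {w + s * w} (λ x → 𝟙-nor (allOnes (take w x)) (tribes w s (drop w x))))
    (trans (∑-split-* w (λ a → 𝟙 (not (allOnes a))) (λ y → 𝟙 (not (tribes w s y))))
           (cong₂ _*_ (∑-not-allOnes w) (∑-not-tribes s)))
    where
    𝟙-nor : ∀ a b → 𝟙 (not (a ∨ b)) ≡ 𝟙 (not a) * 𝟙 (not b)
    𝟙-nor false b = sym (+-identityʳ (𝟙 (not b)))
    𝟙-nor true  b = refl

  -- For `y` in the source, the average of the identity and the plan `W`, scaled by `2 * k ^ s` to
  -- stay in the integers.
  V : ∀ s → Vec Bool (s * w) → Vec Bool (s * w) → ℕ
  V s u y = 𝟙 (tribes w s y) * (𝟙 (eqᵇ u y) * k ^ s + W s u y)

  V-row : ∀ s y → tribes w s y ≡ true → ∑ (λ u → V s u y) ≡ 2 * k ^ s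
  V-row s y t rewrite t = begin
    ∑ (λ u → 1 * (𝟙 (eqᵇ u y) * k ^ s + W s u y))
      ≡⟨ ∑-cong (λ u → trans (*-identityˡ _) (cong (λ e → 𝟙 e * k ^ s + W s u y) (eqᵇ-sym u y))) ⟩
    ∑ (λ u → 𝟙 (eqᵇ y u) * k ^ s + W s u y)
      ≡⟨ ∑-+ (λ u → 𝟙 (eqᵇ y u) * k ^ s) (λ u → W s u y) ⟩
    ∑ (λ u → 𝟙 (eqᵇ y u) * k ^ s) + ∑ (λ u → W s u y)
      ≡⟨ cong₂ _+_ (∑-eqᵇ y (λ _ → k ^ s)) (trans (W-row s y) (sym (+-identityʳ (k ^ s)))) ⟩
    2 * k ^ s ∎
    where open ≡-Reasoning

  -- A one of Tribes receives only its identity mass. A zero `u` receives at most `(2 ^ w) ^ s`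
  -- under `W`, of which `W s u u`, equal to `k ^ s`, comes from `u` itself and is absent from `V`;
  -- `TribesCond` bounds the rest by `k ^ s`.
  V-col : ∀ s → TribesCond w s → ∀ u → ∑ (V s u) ≤ k ^ s
  V-col s cond u with tribes w s u in t
  ... | true  = begin
    ∑ (V s u)                              ≤⟨ ∑-mono pointwise ⟩
    ∑ (λ y → 𝟙 (eqᵇ u y) * k ^ s)          ≡⟨ ∑-eqᵇ u (λ _ → k ^ s) ⟩
    k ^ s                                  ∎
    where
    open ≤-Reasoning
    pointwise : ∀ y → V s u y ≤ 𝟙 (eqᵇ u y) * k ^ s
    pointwise y = begin
      V s u y                                 ≤⟨ *-monoˡ-≤ (𝟙 (eqᵇ u y) * k ^ s + W s u y) (𝟙≤1 (tribes w s y)) ⟩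
      1 * (𝟙 (eqᵇ u y) * k ^ s + W s u y)     ≡⟨ *-identityˡ (𝟙 (eqᵇ u y) * k ^ s + W s u y) ⟩
      𝟙 (eqᵇ u y) * k ^ s + W s u y           ≡⟨ cong (𝟙 (eqᵇ u y) * k ^ s +_) (W-tribes s u y t) ⟩
      𝟙 (eqᵇ u y) * k ^ s + 0                 ≡⟨ +-identityʳ _ ⟩
      𝟙 (eqᵇ u y) * k ^ s                     ∎
  ... | false = +-cancelʳ-≤ (k ^ s) _ _ (begin
    ∑ (V s u) + k ^ s                            ≡⟨ cong (∑ (V s u) +_) (sym (W-diagonal s u t)) ⟩
    ∑ (V s u) + W s u u                          ≡⟨ cong (∑ (V s u) +_) (sym (∑-eqᵇ u (W s u))) ⟩
    ∑ (V s u) + ∑ (λ y → 𝟙 (eqᵇ u y) * W s u y)  ≡⟨ sym (∑-+ (V s u) _) ⟩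
    ∑ (λ y → V s u y + 𝟙 (eqᵇ u y) * W s u y)    ≤⟨ ∑-mono pointwise ⟩
    ∑ (W s u)                                    ≤⟨ W-col s u ⟩
    (2 ^ w) ^ s                                  ≡⟨ ^-*-assoc 2 w s ⟩
    2 ^ (w * s)                                  ≤⟨ cond ⟩
    2 * k ^ s                                    ≡⟨ cong (k ^ s +_) (+-identityʳ (k ^ s)) ⟩
    k ^ s + k ^ s                                ∎)
    where
    open ≤-Reasoning
    pointwise : ∀ y → V s u y + 𝟙 (eqᵇ u y) * W s u y ≤ W s u y
    pointwise y with eqᵇ u y in e
    ... | true  rewrite sym (eqᵇ-sound {x = u} {y} e) | t = ≤-reflexive (+-identityʳ (W s u u))
    ... | false = begin
      𝟙 (tribes w s y) * W s u y + 0   ≡⟨ +-identityʳ _ ⟩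
      𝟙 (tribes w s y) * W s u y       ≤⟨ *-monoˡ-≤ (W s u y) (𝟙≤1 (tribes w s y)) ⟩
      1 * W s u y                      ≡⟨ *-identityˡ (W s u y) ⟩
      W s u y                          ∎

  V-support : ∀ s u y → dist u y ≤ stars s y * w ⊎ V s u y ≡ 0
  V-support s u y with eqᵇ u y in e
  ... | true  = inj₁ (≤-trans (≤-reflexive (trans (cong (dist u) (sym (eqᵇ-sound {x = u} e))) (dist-refl u))) z≤n)
  ... | false with W-support s u y
  ... | inj₁ p = inj₁ p
  ... | inj₂ z = inj₂ (trans (cong (𝟙 (tribes w s y) *_) z) (*-zeroʳ (𝟙 (tribes w s y))))

-- n is kept apart from s * w so that the cast in the theorem is removed by matching on the equation.
record TransportPlan (w s n : ℕ) (T : Vec Bool n → Bool) : Set where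
  field
    V       : Vec Bool n → Vec Bool n → ℕ
    stars   : Vec Bool n → ℕ
    row     : ∀ y → T y ≡ true → ∑ (λ u → V u y) ≡ 2 * (2 ^ w ∸ 1) ^ s
    col     : ∀ u → ∑ (V u) ≤ (2 ^ w ∸ 1) ^ s
    support : ∀ u y → dist u y ≤ stars y * w ⊎ V u y ≡ 0
    ∑-stars : ∑ stars * 2 ^ w ≡ s * 2 ^ n
    size    : ∑ (𝟙 ∘ T) + (2 ^ w ∸ 1) ^ s ≡ 2 ^ n

plan : ∀ w s {n} (eq : n ≡ s * w) → TribesCond w s → TransportPlan w s n (λ x → tribes w s (cast eq x))
plan w s refl cond = record
  { V       = V s
  ; stars   = stars s
  ; row     = λ y t → V-row s y (trans (sym (uncast y)) t)
  ; col     = V-col s cond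
  ; support = V-support s
  ; ∑-stars = ∑-stars s
  ; size    = trans (cong₂ _+_ (∑-cong {s * w} (λ x → cong 𝟙 (uncast x))) (sym (∑-not-tribes s)))
                    (∑-𝟙-not (tribes w s))
  }
  where
  open Plan w
  uncast : ∀ x → tribes w s (cast refl x) ≡ tribes w s x
  uncast x = cong (tribes w s) (cast-is-id refl x)

-- Size of s

-- Bernoulli's inequality `(1 + 1/k) ^ s ≥ 1 + s/k` with denominators cleared.
bernoulli-upper : ∀ k s → k ^ s * (k + s) ≤ suc k ^ s * k
bernoulli-upper k zero    = ≤-reflexive (cong (λ e → e + 0) (+-identityʳ k))
bernoulli-upper k (suc s) = begin
  k * k ^ s * (k + suc s)                ≡⟨ shape k (k ^ s) s ⟩
  k ^ s * (k * (k + s) + k)              ≤⟨ *-monoʳ-≤ (k ^ s) (+-monoʳ-≤ (k * (k + s)) (m≤m+n k s)) ⟩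
  k ^ s * (k * (k + s) + (k + s))        ≡⟨ factor k (k ^ s) s ⟩
  suc k * (k ^ s * (k + s))              ≤⟨ *-monoʳ-≤ (suc k) (bernoulli-upper k s) ⟩
  suc k * (suc k ^ s * k)                ≡⟨ sym (*-assoc (suc k) (suc k ^ s) k) ⟩
  suc k * suc k ^ s * k                  ∎
  where
  open ≤-Reasoning
  shape : ∀ k a s → k * a * (k + (1 + s)) ≡ a * (k * (k + s) + k)
  shape = solve-∀
  factor : ∀ k a s → a * (k * (k + s) + (k + s)) ≡ (1 + k) * (a * (k + s))
  factor = solve-∀

-- Bernoulli's inequality `(1 - 1/(k+1)) ^ t ≥ 1 - t/(k+1)` with denominators cleared; `r` stands
-- for `k + 1 - t`.
bernoulli-lower : ∀ k t r → t + r ≡ suc k → suc k ^ t * r ≤ k ^ t * suc k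
bernoulli-lower k zero    r refl = ≤-refl
bernoulli-lower k (suc t) r eq = begin
  suc k * suc k ^ t * r          ≡⟨ shape (suc k) (suc k ^ t) r ⟩
  suc k ^ t * (r + k * r)        ≤⟨ *-monoʳ-≤ (suc k ^ t) (+-monoˡ-≤ (k * r) r≤k) ⟩
  suc k ^ t * (k + k * r)        ≡⟨ factor (suc k ^ t) k r ⟩
  k * (suc k ^ t * suc r)        ≤⟨ *-monoʳ-≤ k (bernoulli-lower k t (suc r) (trans (+-suc t r) eq)) ⟩
  k * (k ^ t * suc k)            ≡⟨ sym (*-assoc k (k ^ t) (suc k)) ⟩
  k * k ^ t * suc k              ∎
  where
  open ≤-Reasoning
  r≤k : r ≤ k
  r≤k = ≤-trans (m≤n+m r t) (≤-reflexive (suc-injective eq))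
  shape : ∀ a b r → a * b * r ≡ b * (a * r)
  shape = solve-∀
  factor : ∀ a k r → a * (k + k * r) ≡ k * (a * (1 + r))
  factor = solve-∀

-- The condition says `(1 + 1/k) ^ s ≤ 2`, while the left side is at least `1 + s/k`.
TribesCond⇒s≤2^w∸1 : ∀ w s → 1 ≤ w → TribesCond w s → s ≤ 2 ^ w ∸ 1
TribesCond⇒s≤2^w∸1 w s 1≤w cond = +-cancelˡ-≤ k s k (*-cancelˡ-≤ (k ^ s) (begin
  k ^ s * (k + s)        ≤⟨ bernoulli-upper k s ⟩
  suc k ^ s * k          ≡⟨ cong (λ e → e ^ s * k) (sym 2^w≡1+k) ⟩
  (2 ^ w) ^ s * k        ≡⟨ cong (_* k) (^-*-assoc 2 w s) ⟩
  2 ^ (w * s) * k        ≤⟨ *-monoˡ-≤ k cond ⟩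
  2 * k ^ s * k          ≡⟨ shape (k ^ s) k ⟩
  k ^ s * (k + k)        ∎))
  where
  open ≤-Reasoning
  open Plan w using (k; 2^w≡1+k)
  instance
    k≢0 : NonZero k
    k≢0 = >-nonZero (∸-monoˡ-≤ 1 (^-monoʳ-≤ 2 1≤w))
    k^s≢0 : NonZero (k ^ s)
    k^s≢0 = m^n≢0 k s
  shape : ∀ a k → 2 * a * k ≡ a * (k + k)
  shape = solve-∀

-- Bernoulli at half the alphabet size, where `t` and `r` are both `2 ^ w`.
TribesCond-half : ∀ w → TribesCond (suc w) (2 ^ w)
TribesCond-half w = *-cancelʳ-≤ _ _ t (begin
  2 ^ (suc w * t) * t        ≡⟨ cong (_* t) (trans (sym (^-*-assoc 2 (suc w) t)) (cong (_^ t) 2^w≡1+k)) ⟩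
  suc k ^ t * t              ≤⟨ bernoulli-lower k t t (trans (cong (t +_) (sym (+-identityʳ t))) 2^w≡1+k) ⟩
  k ^ t * suc k              ≡⟨ cong (k ^ t *_) (sym 2^w≡1+k) ⟩
  k ^ t * (2 * t)            ≡⟨ shape (k ^ t) t ⟩
  2 * k ^ t * t              ∎)
  where
  open ≤-Reasoning
  open Plan (suc w) using (k; 2^w≡1+k)
  t : ℕ
  t = 2 ^ w
  instance
    t≢0 : NonZero t
    t≢0 = m^n≢0 2 w
  shape : ∀ a t → a * (2 * t) ≡ 2 * a * t
  shape = solve-∀

-- By maximality `s` is at least half of `2 ^ w`, and the factor `w ≥ 2` makes up for the half. For
-- `w = 1` one has `s * w = 1`, whose logarithm is 0.
IsLargestS⇒w≤log : ∀ w s → 2 ≤ w → IsLargestS w s → w ≤ ⌊log₂ (s * w) ⌋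
IsLargestS⇒w≤log (suc w) s 2≤w (_ , largest) = begin
  suc w                        ≡⟨ sym (⌊log₂[2^n]⌋≡n (suc w)) ⟩
  ⌊log₂ (2 ^ suc w) ⌋          ≤⟨ ⌊log₂⌋-mono-≤ (≤-trans (≤-reflexive (*-comm 2 (2 ^ w)))
                                   (*-mono-≤ (largest (2 ^ w) (TribesCond-half w)) 2≤w)) ⟩
  ⌊log₂ (s * suc w) ⌋          ∎
  where open ≤-Reasoning

-- (2 ^ w ∸ 1) ^ s is the number of zeros of Tribes; failure of the defining
-- condition at s + 1 bounds its excess over half the cube.
zeros-excess : ∀ w s m → IsLargestS w s → suc m ≡ s * w →
  (2 ^ w ∸ 1) * (2 ^ w ∸ 1) ^ s ≤ (2 ^ w ∸ 1) * 2 ^ m + 2 ^ m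
zeros-excess w s m (_ , largest) eq = *-cancelˡ-≤ 2 (begin
  2 * (k * k ^ s)              ≤⟨ <⇒≤ (≰⇒> (λ cond → <⇒≱ {s} ≤-refl (largest (suc s) cond))) ⟩
  2 ^ (w * suc s)              ≡⟨ cong (2 ^_) (trans (*-comm w (suc s)) (cong (w +_) (sym eq))) ⟩
  2 ^ (w + suc m)              ≡⟨ ^-distribˡ-+-* 2 w (suc m) ⟩
  2 ^ w * (2 * 2 ^ m)          ≡⟨ cong (_* (2 * 2 ^ m)) 2^w≡1+k ⟩
  suc k * (2 * 2 ^ m)          ≡⟨ shape k (2 ^ m) ⟩
  2 * (k * 2 ^ m + 2 ^ m)      ∎)
  where
  open ≤-Reasoning
  open Plan w using (k; 2^w≡1+k)
  shape : ∀ k h → (1 + k) * (2 * h) ≡ 2 * (k * h + h)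
  shape = solve-∀

-- The total displacement

excess-scale : ∀ {k s} M H → s ≤ k → H ≤ M → k * M ≤ k * H + H → s * M ≤ s * H + H
excess-scale {k} {s} M H s≤k H≤M h = begin
  s * M               ≡⟨ cong (s *_) (sym (m+[n∸m]≡n H≤M)) ⟩
  s * (H + d)         ≡⟨ *-distribˡ-+ s H d ⟩
  s * H + s * d       ≤⟨ +-monoʳ-≤ (s * H) (≤-trans (*-monoˡ-≤ d s≤k) kd≤H) ⟩
  s * H + H           ∎
  where
  open ≤-Reasoning
  -- In terms of the excess `d` the hypothesis reads `k * d ≤ H`, and `s ≤ k` allows `s` in place of
  -- `k`.
  d : ℕ
  d = M ∸ H
  kd≤H : k * d ≤ H
  kd≤H = +-cancelˡ-≤ (k * H) _ _ (begin
    k * H + k * d     ≡⟨ sym (*-distribˡ-+ k H d) ⟩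
    k * (H + d)       ≡⟨ cong (k *_) (m+[n∸m]≡n H≤M) ⟩
    k * M             ≤⟨ h ⟩
    k * H + H         ∎)

-- The four units of `w * 2 ^ m` are one for the last bit, two for the all-ones blocks, and one for
-- the points of `P` outside `T`, which number `M - H` and cost `s * w` each.
short-bijection : ∀ w s m → 2 ≤ w → IsLargestS w s → (eq : suc m ≡ s * w) →
  (P : Vec Bool (suc m) → Bool) → (∀ x → tribes w s (cast eq x) ≡ true → P x ≡ true) → count P ≡ 2 ^ m →
  Σ (Bijection (setoid (Vec Bool m)) (setoid (Σ (Vec Bool (suc m)) (λ y → P y ≡ true))))
    λ φ → totalDisplacement (Bijection.to φ) ≤ 4 * w * 2 ^ m
-- Adding `suc m * (A + M)`, equal to `suc m * (2 * H)`, to both sides avoids truncated subtraction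
-- in `M - H` and `H - A`.
short-bijection w s m 2≤w sMax@(cond , _) eq P T⊑P count≡ = φ , +-cancelʳ-≤ (suc m * (A + M)) _ _ (begin
  totalDisplacement to + suc m * (A + M)
    ≤⟨ +-monoˡ-≤ (suc m * (A + M)) displacement≤ ⟩
  ∑ g + suc m * (A + M)
    ≡⟨ trans (cong (∑ g +_) (*-distribˡ-+ (suc m) A M)) (sym (+-assoc (∑ g) (suc m * A) (suc m * M))) ⟩
  (∑ g + suc m * A) + suc m * M
    ≤⟨ +-mono-≤ cost (≤-trans (≤-reflexive (swap s w M eq)) (*-monoʳ-≤ w sM≤)) ⟩
  ((H + ∑ stars * w) + suc m * H) + w * (s * H + H)
    ≤⟨ +-monoˡ-≤ (w * (s * H + H)) (+-monoˡ-≤ (suc m * H) (+-mono-≤ H≤wH (*-monoˡ-≤ w stars≤))) ⟩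
  ((w * H + 2 * H * w) + suc m * H) + w * (s * H + H)
    ≡⟨ cong (λ n → ((w * H + 2 * H * w) + n * H) + w * (s * H + H)) eq ⟩
  ((w * H + 2 * H * w) + s * w * H) + w * (s * H + H)
    ≡⟨ collect w s H ⟩
  4 * w * H + s * w * (2 * H)
    ≡⟨ cong₂ (λ n e → 4 * w * H + n * e) (sym eq) (sym size) ⟩
  4 * w * H + suc m * (A + M) ∎)
  where
  open ≤-Reasoning
  open TransportPlan (plan w s eq cond)
  open Plan w using (k; 2^w≡1+k)
  T : Vec Bool (suc m) → Bool
  T x = tribes w s (cast eq x)
  H M A : ℕ
  H = 2 ^ m
  M = k ^ s
  A = ∑ (𝟙 ∘ T)
  instance
    k≢0 : NonZero k
    k≢0 = >-nonZero (∸-monoˡ-≤ 1 (^-monoʳ-≤ 2 (≤-trans (s≤s z≤n) 2≤w)))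
    M≢0 : NonZero M
    M≢0 = m^n≢0 k s
    2^w≢0 : NonZero (2 ^ w)
    2^w≢0 = m^n≢0 2 w
  ∑P : ∑ (𝟙 ∘ P) ≡ H
  ∑P = trans (sym (∑-allVecs (𝟙 ∘ P))) count≡
  transported : _
  transported = transport P T (λ y → stars y * w) V M ∑P row col support
  φ : Bijection (setoid (Vec Bool m)) (setoid (Σ (Vec Bool (suc m)) (λ y → P y ≡ true)))
  φ = proj₁ transported
  open Bijection φ using (to; injective)
  h g : Vec Bool (suc m) → ℕ
  h y = if T y then suc (stars y * w) else suc m
  g y = 𝟙 (P y) * h y
  φ-injective : ∀ {x x′} → proj₁ (to x) ≡ proj₁ (to x′) → x ≡ x′
  φ-injective e = injective (subset-≡ P e)
  displacement≤ : totalDisplacement to ≤ ∑ g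
  displacement≤ = begin
    totalDisplacement to                         ≡⟨ ∑-allVecs (λ x → dist (embed x) (proj₁ (to x))) ⟩
    ∑ (λ x → dist (embed x) (proj₁ (to x)))      ≤⟨ ∑-mono (λ x → ≤-trans (proj₂ transported x) (in-P (to x))) ⟩
    ∑ (λ x → g (proj₁ (to x)))                   ≤⟨ ∑-inject (proj₁ ∘ to) g φ-injective ⟩
    ∑ g                                          ∎
    where
    in-P : ∀ (a : Σ (Vec Bool (suc m)) (λ y → P y ≡ true)) → h (proj₁ a) ≤ g (proj₁ a)
    in-P (y , p) rewrite p = ≤-reflexive (sym (*-identityˡ (h y)))
  -- The term `suc m * 𝟙 (T y)` on the left cancels the charge `suc m` that the right side makes for
  -- every point of `P`, so that only points outside `T` pay it.
  pointwise : ∀ y → g y + suc m * 𝟙 (T y) ≤ (𝟙 (P y) + stars y * w) + suc m * 𝟙 (P y)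
  pointwise y with T y in t | P y in p
  ... | true  | true  = ≤-reflexive (cong (_+ suc m * 1) (*-identityˡ (suc (stars y * w))))
  ... | true  | false with () ← trans (sym (T⊑P y t)) p
  ... | false | false = m≤n+m (suc m * 0) (stars y * w)
  ... | false | true  = begin
    1 * suc m + suc m * 0                   ≡⟨ shape m ⟩
    suc m * 1                               ≤⟨ m≤n+m (suc m * 1) (1 + stars y * w) ⟩
    (1 + stars y * w) + suc m * 1           ∎
    where
    shape : ∀ m → 1 * (1 + m) + (1 + m) * 0 ≡ (1 + m) * 1
    shape = solve-∀
  cost : ∑ g + suc m * A ≤ (H + ∑ stars * w) + suc m * H
  cost = begin
    ∑ g + suc m * A
      ≡⟨ cong (∑ g +_) (sym (∑-*ˡ (suc m) (𝟙 ∘ T))) ⟩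
    ∑ g + ∑ (λ y → suc m * 𝟙 (T y))
      ≡⟨ sym (∑-+ g (λ y → suc m * 𝟙 (T y))) ⟩
    ∑ (λ y → g y + suc m * 𝟙 (T y))
      ≤⟨ ∑-mono pointwise ⟩
    ∑ (λ y → (𝟙 (P y) + stars y * w) + suc m * 𝟙 (P y))
      ≡⟨ ∑-+ (λ y → 𝟙 (P y) + stars y * w) (λ y → suc m * 𝟙 (P y)) ⟩
    ∑ (λ y → 𝟙 (P y) + stars y * w) + ∑ (λ y → suc m * 𝟙 (P y))
      ≡⟨ cong₂ _+_ (trans (∑-+ (𝟙 ∘ P) (λ y → stars y * w)) (cong₂ _+_ ∑P (∑-*ʳ stars w)))
                   (trans (∑-*ˡ (suc m) (𝟙 ∘ P)) (cong (suc m *_) ∑P)) ⟩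
    (H + ∑ stars * w) + suc m * H ∎
  s≤k : s ≤ k
  s≤k = TribesCond⇒s≤2^w∸1 w s (≤-trans (s≤s z≤n) 2≤w) cond
  H≤wH : H ≤ w * H
  H≤wH = ≤-trans (≤-reflexive (sym (*-identityˡ H))) (*-monoˡ-≤ H (≤-trans (s≤s z≤n) 2≤w))
  -- On average a point has at most one all-ones block, because `s ≤ 2 ^ w`.
  stars≤ : ∑ stars ≤ 2 * H
  stars≤ = *-cancelʳ-≤ _ _ (2 ^ w) (begin
    ∑ stars * 2 ^ w        ≡⟨ ∑-stars ⟩
    s * (2 * H)            ≤⟨ *-monoˡ-≤ (2 * H) (≤-trans s≤k (m∸n≤m (2 ^ w) 1)) ⟩
    2 ^ w * (2 * H)        ≡⟨ *-comm (2 ^ w) (2 * H) ⟩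
    2 * H * 2 ^ w          ∎)
  sM≤ : s * M ≤ s * H + H
  sM≤ = excess-scale M H s≤k
    -- `TribesCond` with a factor 2 cancelled: at least half of the cube consists of zeros.
    (*-cancelˡ-≤ 2 (≤-trans (≤-reflexive (cong (2 ^_) (trans eq (*-comm s w)))) cond))
    (zeros-excess w s m sMax eq)
  swap : ∀ s w M {n} → n ≡ s * w → n * M ≡ w * (s * M)
  swap s w M refl = trans (cong (_* M) (*-comm s w)) (*-assoc w s M)
  collect : ∀ w s H → ((w * H + 2 * H * w) + s * w * H) + w * (s * H + H) ≡ 4 * w * H + s * w * (2 * H)
  collect = solve-∀

theorem4 : ∃ λ (C : ℕ) → 0 < C ×
    ((w s m : ℕ) → 2 ≤ w → IsLargestS w s → (eq : suc m ≡ s * w) →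
    (P : Vec Bool (suc m) → Bool) →
    (∀ x → tribes w s (cast eq x) ≡ true → P x ≡ true) →
    count P ≡ 2 ^ m →
    Σ (Bijection (setoid (Vec Bool m)) (setoid (Σ (Vec Bool (suc m)) (λ y → P y ≡ true))))
    λ φ → totalDisplacement (Bijection.to φ) ≤ C * ⌊log₂ (suc m) ⌋ * 2 ^ m
    × totalStretch (Bijection.to φ) ≤ (2 * C * ⌊log₂ (suc m) ⌋ + 1) * (m * 2 ^ m))
-- The constant is that of `short-bijection`, in which `w` is then replaced by the logarithm.
theorem4 = 4 , s≤s z≤n , λ w s m 2≤w sMax eq P T⊑P size →
  let φ , short = short-bijection w s m 2≤w sMax eq P T⊑P size
      L         = ⌊log₂ (suc m) ⌋
      w≤L       = subst (λ n → w ≤ ⌊log₂ n ⌋) (sym eq) (IsLargestS⇒w≤log w s 2≤w sMax)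
      short′    = ≤-trans short (*-monoˡ-≤ (2 ^ m) (*-monoʳ-≤ 4 w≤L))
  in φ , short′ , (begin
    totalStretch (Bijection.to φ)                         ≤⟨ totalStretch≤ (Bijection.to φ) ⟩
    m * (2 * totalDisplacement (Bijection.to φ) + 2 ^ m)  ≤⟨ *-monoʳ-≤ m (+-monoˡ-≤ (2 ^ m) (*-monoʳ-≤ 2 short′)) ⟩
    m * (2 * (4 * L * 2 ^ m) + 2 ^ m)                     ≡⟨ shape m L (2 ^ m) ⟩
    (2 * 4 * L + 1) * (m * 2 ^ m)                         ∎)
  where
  open ≤-Reasoning
  shape : ∀ m L H → m * (2 * (4 * L * H) + H) ≡ (2 * 4 * L + 1) * (m * H)
  shape = solve-∀
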